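{- Let $D\ge2$ be squarefree and $K=\mathbb{Q}(\sqrt D)$. The uniquely decomposable elements $x\in\mathcal{O}_K^+$ are exactly the following: (a) $\alpha_{i,r}$ with odd $i\ge-1$ and $0\le r\le u_{i+2}-1$; (b) $e\alpha_{i,0}$ with odd $i\ge-1$ and $2\le e\le u_{i+1}+1$; (c) $\alpha_{i,u_{i+2}-1}+f\alpha_{i+2,0}$ with odd $i\ge-1$ such that $u_{i+2}\ge2$, and $1\le f\le u_{i+3}$; (d) $e\alpha_{i,0}+\alpha_{i,1}$ with odd $i\ge-1$ such that $u_{i+2}\ge2$, and $1\le e\le u_{i+1}$; (e) $e\alpha_{i,0}+f\alpha_{i+2,0}$ with odd $i\ge-1$ such that $u_{i+2}=1$, and $1\le e\le u_{i+1}+1$, $1\le f\le u_{i+3}+1$, $(e,f)\ne(u_{i+1}+1,u_{i+3}+1)$; (f) Galois conjugates of all elements in (a)–(e).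
   Context: $D\ge2$ is squarefree, $K=\mathbb{Q}(\sqrt D)$, $\mathcal{O}_K$ its ring of integers, $x'$ the Galois conjugate. Let $\omega_D=\sqrt D$ if $D\equiv 2,3\pmod 4$ and $\omega_D=\frac{1+\sqrt D}{2}$ if $D\equiv1\pmod4$. $\mathcal{O}_K^+$ is the set of $\alpha\in\mathcal{O}_K$ with $\alpha>0,\alpha'>0$; $\alpha\in\mathcal{O}_K^+$ is indecomposable if it is not a sum of two elements of $\mathcal{O}_K^+$, and uniquely decomposable if there is exactly one way (up to order of summands) to write it as a sum of indecomposable elements. Let $\sigma_D=\omega_D+\lfloor-\omega_D'\rfloor=[\overline{u_0,\dots,u_{s-1}}]$ (purely periodic continued fraction, positive integers $u_i$), extended by $u_{i+s}=u_i$. Define $p_{ -1}=1,q_{ -1}=0,p_0=\lceil u_0/2\rceil,q_0=1$, $X_{i+2}=u_{i+2}X_{i+1}+X_i$ ($i\ge-1$, $X\in\{p,q\}$), $\alpha_i=p_i-q_i\omega_D'$, $\alpha_{i,r}=\alpha_i+r\alpha_{i+1}$. -}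

module Defs where

open import Data.Nat as ℕ using (ℕ; zero; suc; _≤ᵇ_; _≡ᵇ_)
open import Data.Nat.DivMod using (_/_; _%_)
open import Data.Nat.Divisibility using (_∣_)
open import Data.Integer as ℤ using (ℤ; +_)
open import Data.Bool using (Bool; true; false; if_then_else_)
open import Data.Product using (Σ; ∃; ∃-syntax; _×_; _,_)
open import Data.Sum using (_⊎_)
open import Data.List using (List; []; _∷_; foldr)
open import Data.List.Relation.Unary.All using (All)
open import Data.List.Relation.Binary.Permutation.Propositional using (_↭_)
open import Relation.Nullary using (¬_)
open import Relation.Binary.PropositionalEquality using (_≡_)

SquareFree : ℕ → Set
SquareFree D = ∀ (n : ℕ) → (n ℕ.* n) ∣ D → n ≡ 1

is1mod4 : ℕ → Bool
is1mod4 D = (D % 4) ≡ᵇ 1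

isqrt : ℕ → ℕ
isqrt zero = zero
isqrt (suc n) with isqrt n
... | s = if (suc s ℕ.* suc s) ≤ᵇ suc n then suc s else s

-- division with a total convention for divisor 0 (never used with 0 below)
_div_ : ℕ → ℕ → ℕ
n div zero = zero
n div suc q = n / suc q

-- The continued fraction of σ_D = ω_D + ⌊-ω_D'⌋.
-- Every complete quotient σ_i is written (P_i + √D)/Q_i with P_i, Q_i
-- positive integers (σ_D is reduced, hence so are all σ_i), and the
-- standard algorithm is used:
--   u_i = ⌊σ_i⌋ = ⌊(P_i + ⌊√D⌋)/Q_i⌋,  P_{i+1} = u_i Q_i - P_i,
--   Q_{i+1} = (D - P_{i+1}²)/Q_i,  so that σ_{i+1} = 1/(σ_i - u_i).
-- Initial data:  D ≡ 2,3 (mod 4): σ_D = √D + ⌊√D⌋ = (⌊√D⌋ + √D)/1;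
--                D ≡ 1 (mod 4):   σ_D = (1+√D)/2 + ⌊(√D-1)/2⌋
--                                     = (2⌊(⌊√D⌋-1)/2⌋ + 1 + √D)/2.

cfInit : ℕ → ℕ × ℕ
cfInit D = if is1mod4 D
           then (2 ℕ.* ((isqrt D ℕ.∸ 1) / 2) ℕ.+ 1 , 2)
           else (isqrt D , 1)

cfStep : ℕ → ℕ × ℕ → ℕ × ℕ
cfStep D (P , Q) =
  let a  = (P ℕ.+ isqrt D) div Q
      P' = a ℕ.* Q ℕ.∸ P
  in (P' , (D ℕ.∸ P' ℕ.* P') div Q)

cfState : ℕ → ℕ → ℕ × ℕ
cfState D zero = cfInit D
cfState D (suc i) = cfStep D (cfState D i)

-- u D i = u_i, the i-th partial quotient of σ_D = [u_0, u_1, ...]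
-- (the expansion is purely periodic, so this is u_i for all i ≥ 0)
u : ℕ → ℕ → ℕ
u D i with cfState D i
... | (P , Q) = (P ℕ.+ isqrt D) div Q

-- Elements of O_K, K = ℚ(√D):  a + b ω_D  represented as  a ω+ b.

record OK : Set where
  constructor _ω+_
  field
    a : ℤ
    b : ℤ
open OK public

infixl 6 _⊕_
_⊕_ : OK → OK → OK
(a₁ ω+ b₁) ⊕ (a₂ ω+ b₂) = (a₁ ℤ.+ a₂) ω+ (b₁ ℤ.+ b₂)

zeroK : OK
zeroK = (+ 0) ω+ (+ 0)

infixl 7 _·_
_·_ : ℕ → OK → OK
n · (x ω+ y) = (+ n ℤ.* x) ω+ (+ n ℤ.* y)

sumK : List OK → OK
sumK = foldr _⊕_ zeroK

-- Galois conjugate x ↦ x'.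
--   D ≡ 2,3: ω' = -ω,     so (a + bω)' = a - bω
--   D ≡ 1  : ω' = 1 - ω,  so (a + bω)' = (a + b) - bω
conj : ℕ → OK → OK
conj D (x ω+ y) = if is1mod4 D then (x ℤ.+ y) ω+ (ℤ.- y) else x ω+ (ℤ.- y)

-- The real number (X + Y√D) is > 0 (D ≥ 2), written with integers only.
PosSurd : ℕ → ℤ → ℤ → Set
PosSurd D X Y =
    (+ 0 ℤ.≤ X × + 0 ℤ.≤ Y × (+ 0 ℤ.< X ⊎ + 0 ℤ.< Y))
  ⊎ (+ 0 ℤ.< X × Y ℤ.< + 0 × Y ℤ.* Y ℤ.* + D ℤ.< X ℤ.* X)
  ⊎ (X ℤ.< + 0 × + 0 ℤ.< Y × X ℤ.* X ℤ.< Y ℤ.* Y ℤ.* + D)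

-- 2(a + bω_D) = X + Y√D with
--   D ≡ 2,3: X = 2a, Y = 2b;   D ≡ 1: X = 2a + b, Y = b.
-- Pos D α  ⇔  α > 0 (in the embedding √D ↦ positive root)
Pos : ℕ → OK → Set
Pos D (x ω+ y) =
  if is1mod4 D then PosSurd D (+ 2 ℤ.* x ℤ.+ y) y
               else PosSurd D (+ 2 ℤ.* x) (+ 2 ℤ.* y)

TotPos : ℕ → OK → Set
TotPos D α = Pos D α × Pos D (conj D α)

Indecomposable : ℕ → OK → Set
Indecomposable D α =
  TotPos D α × ¬ (∃[ β ] ∃[ γ ] (TotPos D β × TotPos D γ × α ≡ β ⊕ γ))

UniquelyDecomposable : ℕ → OK → Set
UniquelyDecomposable D α =
  TotPos D α ×
  Σ (List OK) λ L → All (Indecomposable D) L × sumK L ≡ α ×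
    (∀ (L' : List OK) → All (Indecomposable D) L' → sumK L' ≡ α → L' ↭ L)

-- Convergent-type sequences, with the index SHIFTED by one:
--   pp D j = p_{j-1},  qq D j = q_{j-1}   (j ≥ 0, i.e. i = j-1 ≥ -1)

pq : ℕ → ℕ → ℕ × ℕ
pq D zero = (1 , 0)
pq D (suc zero) = ((u D 0 ℕ.+ 1) / 2 , 1)
pq D (suc (suc j)) with pq D j | pq D (suc j)
... | (p₀ , q₀) | (p₁ , q₁) =
  (u D (suc j) ℕ.* p₁ ℕ.+ p₀ , u D (suc j) ℕ.* q₁ ℕ.+ q₀)

-- αs D j = α_{j-1} = p_{j-1} - q_{j-1} ω_D'
--   D ≡ 2,3: ω' = -ω :  p + q ω
--   D ≡ 1  : ω' = 1-ω:  (p - q) + q ω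
αs : ℕ → ℕ → OK
αs D j with pq D j
... | (p , q) = if is1mod4 D then (+ p ℤ.- + q) ω+ (+ q) else (+ p) ω+ (+ q)

αr : ℕ → ℕ → ℕ → OK
αr D j r = αs D j ⊕ r · αs D (suc j)

-- The families (a)–(e).  Odd i ≥ -1 is written i = 2k - 1 (k ≥ 0), so
-- shifted index j = i + 1 = 2k, and
--   u_{i+1} = u D (2k), u_{i+2} = u D (2k+1), u_{i+3} = u D (2k+2),
--   α_{i,r} = αr D (2k) r,  α_{i+2,0} = αr D (2k+2) 0.

Listed : ℕ → OK → Set
Listed D x = ∃[ k ] let j = 2 ℕ.* k in
    (∃[ r ] (r ℕ.≤ u D (1 ℕ.+ j) ℕ.∸ 1 × x ≡ αr D j r))
  ⊎ (∃[ e ] (2 ℕ.≤ e × e ℕ.≤ u D j ℕ.+ 1 × x ≡ e · αr D j 0))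
  ⊎ (2 ℕ.≤ u D (1 ℕ.+ j) × ∃[ f ] (1 ℕ.≤ f × f ℕ.≤ u D (2 ℕ.+ j) ×
        x ≡ αr D j (u D (1 ℕ.+ j) ℕ.∸ 1) ⊕ f · αr D (2 ℕ.+ j) 0))
  ⊎ (2 ℕ.≤ u D (1 ℕ.+ j) × ∃[ e ] (1 ℕ.≤ e × e ℕ.≤ u D j ×
        x ≡ e · αr D j 0 ⊕ αr D j 1))
  ⊎ (u D (1 ℕ.+ j) ≡ 1 × ∃[ e ] ∃[ f ] (1 ℕ.≤ e × e ℕ.≤ u D j ℕ.+ 1 ×
        1 ℕ.≤ f × f ℕ.≤ u D (2 ℕ.+ j) ℕ.+ 1 ×
        ¬ (e ≡ u D j ℕ.+ 1 × f ≡ u D (2 ℕ.+ j) ℕ.+ 1) ×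
        x ≡ e · αr D j 0 ⊕ f · αr D (2 ℕ.+ j) 0))

{-# OPTIONS --safe #-}

-- The indecomposables α_{i,r} (i odd) and their conjugates form a bi-infinite sequence β_m with
-- β_{m-1} + β_{m+1} = c_m β_m and c_m ≥ 2, consecutive terms being bases of O_K whose cones cover
-- O_K⁺; here c_m = u_{i+1} + 2 if β_m = α_{i,0}, and c_m = 2 at the other vertices.
-- Write x = e β_m + f β_{m+1}. If e ≥ c_m, or f ≥ c_{m+1}, or both e = c_m - 1 and f = c_{m+1} - 1,
-- the recurrence yields a second decomposition. Otherwise there is none: along the sequence, each
-- coordinate in the basis β_m, β_{m+1} and their sum grow convexly on either side of the basis, so
-- a decomposition containing any other β_k makes a coordinate or the sum too large.
module Submission where

open import Defs
open import Data.Bool using (Bool; true; false; if_then_else_; T)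
open import Data.Empty using (⊥; ⊥-elim)
open import Data.Integer as ℤ using (ℤ; +_; -[1+_]; _+_; _*_; _-_; -_; +≤+)
import Data.Integer.Properties as ℤₚ
open import Algebra.Properties.AbelianGroup ℤₚ.+-0-abelianGroup using (∙-cancelˡ)
open import Data.Integer.Tactic.RingSolver using (solve; solve-∀)
open import Data.List using (List; []; _∷_; _++_; replicate)
open import Data.List.Membership.Propositional using (_∈_)
open import Data.List.Relation.Binary.Permutation.Propositional using (_↭_; ↭-refl; ↭-sym; ↭-trans; prep)
import Data.List.Relation.Binary.Permutation.Propositional.Properties as ↭ₚ
open import Data.List.Relation.Unary.All as All using (All)
import Data.List.Relation.Unary.All.Properties as Allₚ
open import Data.List.Relation.Unary.Any using (here)
open import Data.Nat as ℕ using (ℕ; zero; suc; z≤n; s≤s; _≤_; _≤ᵇ_)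
open import Data.Nat.DivMod using (_/_; _%_)
import Data.Nat.DivMod as DivMod
open import Data.Nat.Divisibility using (divides)
import Data.Nat.Properties as ℕₚ
open import Data.Product using (∃-syntax; _×_; _,_; proj₁; proj₂)
open import Data.Sum using (_⊎_; inj₁; inj₂; [_,_]′)
open import Data.Unit using (tt)
open import Function.Bundles using (_⇔_; mk⇔; Equivalence)
open import Relation.Nullary using (¬_; yes; no)
open import Relation.Binary.PropositionalEquality

-- The difficulty in uniqueness is cancellation: a summand to the right of the basis may have a
-- negative first coordinate, one to the left a negative second coordinate, so an excess on one side
-- might be compensated from the other. The coordinate sum records the price. A summand on the left
-- contributes at least c_m - 1 to it, one on the right at least c_{m+1} - 1, and no summand a
-- negative amount, so a mixture reaches c_m + c_{m+1} - 2, which is the sum at the excluded corner.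
-- That the cones cover O_K⁺ is a descent: an element with a negative coefficient on β_m is
-- rewritten in the next basis, where the second coefficient is smaller. The decrease holds because
-- β_{m+1} - β_m is an α_i with even i, whose norm is negative. The signs of these norms come from
-- an exact relation between α_i, α_{i+1} and the complete quotients, so that everything is decided
-- by polynomial inequalities over ℤ, without real numbers.

-- Inequalities over ℤ by polynomial certificates

-- A record rather than a synonym for + 0 ≤ i, so that Agda infers i from the type.
record NonNeg (i : ℤ) : Set where
  constructor nonNeg
  field 0≤ : + 0 ℤ.≤ i
open NonNeg public

infixl 6 _⊞_
infixl 7 _⊠_

_⊞_ : ∀ {i j} → NonNeg i → NonNeg j → NonNeg (i + j)
nonNeg p ⊞ nonNeg q = nonNeg (ℤₚ.+-mono-≤ p q)

_⊠_ : ∀ {i j} → NonNeg i → NonNeg j → NonNeg (i * j)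
_⊠_ {+ m} {+ n} _ _ = nonNeg (subst (+ 0 ℤ.≤_) (ℤₚ.pos-* m n) (+≤+ z≤n))

via : ∀ {i j} → NonNeg i → i ≡ j → NonNeg j
via p refl = p

-- Inequality proofs below are certificates: known nonnegative quantities are added and multiplied,
-- and the ring solver checks that the result is the goal or, in a proof by contradiction, the
-- constant -1. A strict inequality i > 0 appears as `NonNeg (i - + 1)`, the negation of `NonNeg i`
-- as `NonNeg (- i - + 1)`.
refute : ∀ {i} → NonNeg i → i ≡ - + 1 → ⊥
refute (nonNeg ()) refl

nat : ∀ {n} → NonNeg (+ n)
nat = nonNeg (+≤+ z≤n)

diff : ∀ {i j} → i ℤ.≤ j → NonNeg (j - i)
diff p = nonNeg (ℤₚ.i≤j⇒0≤j-i p)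

diff< : ∀ {i j} → i ℤ.< j → NonNeg (j - i - + 1)
diff< {i} {j} p = via {j - (+ 1 + i)} (diff (ℤₚ.i<j⇒suc[i]≤j p)) (solve (i ∷ j ∷ []))

diffℕ : ∀ {m n} → m ℕ.≤ n → NonNeg (+ n - + m)
diffℕ p = diff (+≤+ p)

undiff : ∀ {i j} → NonNeg (j - i) → i ℤ.≤ j
undiff (nonNeg p) = ℤₚ.0≤i-j⇒j≤i p

undiffℕ : ∀ {m n} → NonNeg (+ n - + m) → m ℕ.≤ n
undiffℕ p = ℤₚ.drop‿+≤+ (undiff p)

pos : ∀ {i} → + 0 ℤ.< i → NonNeg (i - + 1)
pos {i} p = via {i - + 0 - + 1} (diff< p) (solve (i ∷ []))

unpos : ∀ {i} → NonNeg (i - + 1) → + 0 ℤ.< i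
unpos p = ℤₚ.suc[i]≤j⇒i<j (undiff p)

decide : ∀ i → NonNeg i ⊎ NonNeg (- i - + 1)
decide (+ n) = inj₁ nat
decide -[1+ n ] = inj₂ (via (nat {n}) (eq (+ n)))
  where eq : ∀ i → i ≡ - (- (+ 1 + i)) - + 1
        eq = solve-∀

from-contra : ∀ i → (NonNeg (- i - + 1) → ⊥) → NonNeg i
from-contra i ¬i<0 = [ (λ p → p) , (λ p → ⊥-elim (¬i<0 p)) ]′ (decide i)

*-cancel-pos : ∀ {i j} → NonNeg (i - + 1) → NonNeg (i * j - + 1) → NonNeg (j - + 1)
*-cancel-pos {i} {j} p q = from-contra (j - + 1) λ r →
  refute ((p ⊠ r) ⊞ r ⊞ q) (solve (i ∷ j ∷ []))

-- O_K and its totally positive elements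

infix 4 _≐_
_≐_ : ∀ {i j k l} → i ≡ j → k ≡ l → (i ω+ k) ≡ (j ω+ l)
_≐_ = cong₂ _ω+_

⊕-assoc : ∀ x y z → (x ⊕ y) ⊕ z ≡ x ⊕ (y ⊕ z)
⊕-assoc x y z = ℤₚ.+-assoc (a x) (a y) (a z) ≐ ℤₚ.+-assoc (b x) (b y) (b z)

⊕-comm : ∀ x y → x ⊕ y ≡ y ⊕ x
⊕-comm x y = ℤₚ.+-comm (a x) (a y) ≐ ℤₚ.+-comm (b x) (b y)

⊕-identityˡ : ∀ x → zeroK ⊕ x ≡ x
⊕-identityˡ x = ℤₚ.+-identityˡ (a x) ≐ ℤₚ.+-identityˡ (b x)

⊕-identityʳ : ∀ x → x ⊕ zeroK ≡ x
⊕-identityʳ x = ℤₚ.+-identityʳ (a x) ≐ ℤₚ.+-identityʳ (b x)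

⊕-cancelˡ : ∀ x {y z} → x ⊕ y ≡ x ⊕ z → y ≡ z
⊕-cancelˡ x p = ∙-cancelˡ (a x) _ _ (cong a p) ≐ ∙-cancelˡ (b x) _ _ (cong b p)

suc-· : ∀ n x → suc n · x ≡ x ⊕ n · x
suc-· n (x ω+ y) = eq (+ n) x ≐ eq (+ n) y
  where eq : ∀ i j → (+ 1 + i) * j ≡ j + i * j
        eq = solve-∀

0-· : ∀ x → 0 · x ≡ zeroK
0-· x = ℤₚ.*-zeroˡ (a x) ≐ ℤₚ.*-zeroˡ (b x)

1-· : ∀ x → 1 · x ≡ x
1-· x = ℤₚ.*-identityˡ (a x) ≐ ℤₚ.*-identityˡ (b x)

sumK-++ : ∀ L M → sumK (L ++ M) ≡ sumK L ⊕ sumK M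
sumK-++ [] M = sym (⊕-identityˡ (sumK M))
sumK-++ (x ∷ L) M = trans (cong (x ⊕_) (sumK-++ L M)) (sym (⊕-assoc x (sumK L) (sumK M)))

sumK-replicate : ∀ n x → sumK (replicate n x) ≡ n · x
sumK-replicate zero x = sym (0-· x)
sumK-replicate (suc n) x = trans (cong (x ⊕_) (sumK-replicate n x)) (sym (suc-· n x))

-- Linear functionals, trace, slope and conjugation

record Linear (φ : OK → ℤ) : Set where
  field
    ⊕-homo : ∀ x y → φ (x ⊕ y) ≡ φ x + φ y
    ·-homo : ∀ n x → φ (n · x) ≡ + n * φ x

  combination : ∀ m x n y → φ (m · x ⊕ n · y) ≡ + m * φ x + + n * φ y
  combination m x n y = trans (⊕-homo (m · x) (n · y)) (cong₂ _+_ (·-homo m x) (·-homo n y))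

  zero-homo : φ zeroK ≡ + 0
  zero-homo = trans (cong φ (sym (0-· zeroK))) (trans (·-homo 0 zeroK) (ℤₚ.*-zeroˡ (φ zeroK)))

open Linear public

functional : ∀ i j → Linear (λ x → i * a x + j * b x)
functional i j = record
  { ⊕-homo = λ (x ω+ y) (z ω+ w) → additive x y z w
  ; ·-homo = λ n (x ω+ y) → homogeneous (+ n) x y
  }
  where
  additive : ∀ x y z w → i * (x + z) + j * (y + w) ≡ i * x + j * y + (i * z + j * w)
  additive x y z w = solve (i ∷ j ∷ x ∷ y ∷ z ∷ w ∷ [])
  homogeneous : ∀ n x y → i * (n * x) + j * (n * y) ≡ n * (i * x + j * y)
  homogeneous n x y = solve (i ∷ j ∷ n ∷ x ∷ y ∷ [])

-- 2x = X + Y√D with X = trace D x and Y = slope D x.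
trace slope : ℕ → OK → ℤ
trace D x = if is1mod4 D then + 2 * a x + b x else + 2 * a x
slope D x = if is1mod4 D then b x else + 2 * b x

≗-Linear : ∀ {φ ψ} → (∀ x → φ x ≡ ψ x) → Linear φ → Linear ψ
≗-Linear eq φ-linear = record
  { ⊕-homo = λ x y → trans (sym (eq _)) (trans (⊕-homo φ-linear x y) (cong₂ _+_ (eq x) (eq y)))
  ; ·-homo = λ n x → trans (sym (eq _)) (trans (·-homo φ-linear n x) (cong (+ n *_) (eq x)))
  }

trace-linear : ∀ D → Linear (trace D)
trace-linear D with is1mod4 D
... | true  = ≗-Linear (λ (x ω+ y) → eq x y) (functional (+ 2) (+ 1))
  where eq : ∀ x y → + 2 * x + + 1 * y ≡ + 2 * x + y
        eq = solve-∀
... | false = ≗-Linear (λ (x ω+ y) → eq x y) (functional (+ 2) (+ 0))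
  where eq : ∀ x y → + 2 * x + + 0 * y ≡ + 2 * x
        eq = solve-∀

slope-linear : ∀ D → Linear (slope D)
slope-linear D with is1mod4 D
... | true  = ≗-Linear (λ (x ω+ y) → eq x y) (functional (+ 0) (+ 1))
  where eq : ∀ x y → + 0 * x + + 1 * y ≡ y
        eq = solve-∀
... | false = ≗-Linear (λ (x ω+ y) → eq x y) (functional (+ 0) (+ 2))
  where eq : ∀ x y → + 0 * x + + 2 * y ≡ + 2 * y
        eq = solve-∀

trace-conj : ∀ D x → trace D (conj D x) ≡ trace D x
trace-conj D (x ω+ y) with is1mod4 D
... | true  = eq x y
  where eq : ∀ x y → + 2 * (x + y) + - y ≡ + 2 * x + y
        eq = solve-∀
... | false = refl

slope-conj : ∀ D x → slope D (conj D x) ≡ - slope D x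
slope-conj D (x ω+ y) with is1mod4 D
... | true  = refl
... | false = sym (ℤₚ.neg-distribʳ-* (+ 2) y)

conj-involutive : ∀ D x → conj D (conj D x) ≡ x
conj-involutive D (x ω+ y) with is1mod4 D
... | true  = eq x y ≐ ℤₚ.neg-involutive y
  where eq : ∀ x y → x + y + - y ≡ x
        eq = solve-∀
... | false = refl ≐ ℤₚ.neg-involutive y

conj-⊕ : ∀ D x y → conj D (x ⊕ y) ≡ conj D x ⊕ conj D y
conj-⊕ D (x ω+ y) (z ω+ w) with is1mod4 D
... | true  = eq x y z w ≐ ℤₚ.neg-distrib-+ y w
  where eq : ∀ x y z w → x + z + (y + w) ≡ x + y + (z + w)
        eq = solve-∀
... | false = refl ≐ ℤₚ.neg-distrib-+ y w

conj-· : ∀ D n x → conj D (n · x) ≡ n · conj D x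
conj-· D n (x ω+ y) with is1mod4 D
... | true  = sym (ℤₚ.*-distribˡ-+ (+ n) x y) ≐ ℤₚ.neg-distribʳ-* (+ n) y
... | false = refl ≐ ℤₚ.neg-distribʳ-* (+ n) y

conj-combination : ∀ D m x n y → conj D (m · x ⊕ n · y) ≡ m · conj D x ⊕ n · conj D y
conj-combination D m x n y =
  trans (conj-⊕ D (m · x) (n · y)) (cong₂ _⊕_ (conj-· D m x) (conj-· D n y))

-- Four times the norm of x.
norm : ℕ → OK → ℤ
norm D x = trace D x * trace D x - + D * (slope D x * slope D x)

-- X + Y√d and X - Y√d are both positive exactly when their sum and their product are. This replaces
-- the sign cases of `PosSurd` by two polynomial inequalities that are symmetric under conjugation.
record Positive (d X Y : ℤ) : Set where
  constructor positive
  field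
    trace>0 : NonNeg (X - + 1)
    norm>0  : NonNeg (X * X - d * (Y * Y) - + 1)
open Positive public

positive-conj : ∀ {d X Y} → Positive d X Y → Positive d X (- Y)
positive-conj {d} {X} {Y} (positive p q) = positive p (via q (solve (d ∷ X ∷ Y ∷ [])))

-- By Cauchy–Schwarz for the indefinite form: (XX')² > (dYY')², so XX' − dYY' ≥ 0.
positive-+ : ∀ {d X Y Z W} → NonNeg d → Positive d X Y → Positive d Z W → Positive d (X + Z) (Y + W)
positive-+ {d} {X} {Y} {Z} {W} 0≤d (positive p q) (positive p' q') = positive
  (via (p ⊞ p' ⊞ nat {1}) (solve (X ∷ Z ∷ [])))
  (via (q ⊞ q' ⊞ nat {2} ⊠ cross ⊞ nat {1}) (solve (d ∷ X ∷ Y ∷ Z ∷ W ∷ [])))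
  where
  square : ∀ i → NonNeg (i * i)
  square (+ n) = nat {n} ⊠ nat {n}
  square -[1+ n ] = nat

  cross : NonNeg (X * Z - d * (Y * W))
  cross = from-contra (X * Z - d * (Y * W)) λ r → refute
    (q ⊠ q' ⊞ q ⊞ q' ⊞ (q ⊞ nat {1}) ⊠ (0≤d ⊠ square W) ⊞ (q' ⊞ nat {1}) ⊠ (0≤d ⊠ square Y)
      ⊞ (r ⊞ nat {1}) ⊠ (r ⊞ nat {1} ⊞ nat {2} ⊠ ((p ⊞ nat {1}) ⊠ (p' ⊞ nat {1}))))
    (solve (d ∷ X ∷ Y ∷ Z ∷ W ∷ []))

-- Closure properties of total positivity

module _ (D : ℕ) where

  Positiveₖ : OK → Set
  Positiveₖ x = Positive (+ D) (trace D x) (slope D x)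

  private
    surds⇒positive : ∀ {X Y} → PosSurd D X Y → PosSurd D X (- Y) → Positive (+ D) X Y
    surds⇒positive {X} {Y} (inj₁ (0≤X , 0≤Y , nz)) (inj₁ (_ , 0≤-Y , _))
      with ℤₚ.≤-antisym (ℤₚ.neg-cancel-≤ { - + 0} {Y} 0≤-Y) 0≤Y | nz
    ... | refl | inj₁ 0<X = positive (pos 0<X) (via (pos 0<X ⊠ pos 0<X ⊞ nat {2} ⊠ pos 0<X) (eq X (+ D)))
      where eq : ∀ X d → (X - + 1) * (X - + 1) + + 2 * (X - + 1) ≡ X * X - d * (+ 0 * + 0) - + 1
            eq = solve-∀
    ... | refl | inj₂ 0<0 = ⊥-elim (ℤₚ.<-irrefl refl 0<0)
    surds⇒positive {X} {Y} (inj₁ _) (inj₂ (inj₁ (0<X , _ , lt))) =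
      positive (pos 0<X) (via (diff< lt) (eq X Y (+ D)))
      where eq : ∀ X Y d → X * X - (- Y) * (- Y) * d - + 1 ≡ X * X - d * (Y * Y) - + 1
            eq = solve-∀
    surds⇒positive {X} {Y} (inj₁ (0≤X , _)) (inj₂ (inj₂ (X<0 , _))) = ⊥-elim (ℤₚ.<⇒≱ X<0 0≤X)
    surds⇒positive {X} {Y} (inj₂ (inj₁ (0<X , _ , lt))) _ =
      positive (pos 0<X) (via (diff< lt) (eq X Y (+ D)))
      where eq : ∀ X Y d → X * X - Y * Y * d - + 1 ≡ X * X - d * (Y * Y) - + 1
            eq = solve-∀
    surds⇒positive (inj₂ (inj₂ (X<0 , _))) (inj₁ (0≤X , _)) = ⊥-elim (ℤₚ.<⇒≱ X<0 0≤X)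
    surds⇒positive (inj₂ (inj₂ (X<0 , _))) (inj₂ (inj₁ (0<X , _))) = ⊥-elim (ℤₚ.<-asym X<0 0<X)
    surds⇒positive (inj₂ (inj₂ (_ , 0<Y , _))) (inj₂ (inj₂ (_ , 0<-Y , _))) =
      ⊥-elim (ℤₚ.<-asym 0<Y (ℤₚ.neg-cancel-< { - + 0} 0<-Y))

    positive⇒surd : ∀ {X Y} → Positive (+ D) X Y → PosSurd D X Y
    positive⇒surd {X} {Y} (positive p q) with decide Y
    ... | inj₁ 0≤Y = inj₁ (ℤₚ.<⇒≤ (unpos p) , 0≤ 0≤Y , inj₁ (unpos p))
    ... | inj₂ Y<0 = inj₂ (inj₁ (unpos p , ℤₚ.neg-cancel-< {+ 0} (unpos Y<0) ,
                       ℤₚ.suc[i]≤j⇒i<j (undiff (via q (eq X Y (+ D))))))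
      where eq : ∀ X Y d → X * X - d * (Y * Y) - + 1 ≡ X * X - (+ 1 + Y * Y * d)
            eq = solve-∀

    Pos-surd : ∀ x → Pos D x ≡ PosSurd D (trace D x) (slope D x)
    Pos-surd x with is1mod4 D
    ... | true  = refl
    ... | false = refl

    Pos-conj-surd : ∀ x → Pos D (conj D x) ≡ PosSurd D (trace D x) (- slope D x)
    Pos-conj-surd x = trans (Pos-surd (conj D x)) (cong₂ (PosSurd D) (trace-conj D x) (slope-conj D x))

  TotPos⇒Positive : ∀ {x} → TotPos D x → Positiveₖ x
  TotPos⇒Positive {x} (p , q) =
    surds⇒positive (subst (λ S → S) (Pos-surd x) p) (subst (λ S → S) (Pos-conj-surd x) q)

  Positive⇒TotPos : ∀ {x} → Positiveₖ x → TotPos D x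
  Positive⇒TotPos {x} p =
    subst (λ S → S) (sym (Pos-surd x)) (positive⇒surd p) ,
    subst (λ S → S) (sym (Pos-conj-surd x)) (positive⇒surd (positive-conj p))

  TotPos-conj : ∀ {x} → TotPos D x → TotPos D (conj D x)
  TotPos-conj {x} (p , q) = q , subst (Pos D) (sym (conj-involutive D x)) p

  TotPos-⊕ : ∀ {x y} → TotPos D x → TotPos D y → TotPos D (x ⊕ y)
  TotPos-⊕ {x} {y} p q = Positive⇒TotPos (subst₂ (Positive (+ D))
    (sym (⊕-homo (trace-linear D) x y)) (sym (⊕-homo (slope-linear D) x y))
    (positive-+ nat (TotPos⇒Positive p) (TotPos⇒Positive q)))

  TotPos-· : ∀ n {x} → TotPos D x → TotPos D (suc n · x)
  TotPos-· zero {x} p = subst (TotPos D) (sym (1-· x)) p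
  TotPos-· (suc n) {x} p = subst (TotPos D) (sym (suc-· (suc n) x)) (TotPos-⊕ p (TotPos-· n p))

  TotPos-combination : ∀ m n {x y} → TotPos D x → TotPos D y → 1 ℕ.≤ m ℕ.+ n → TotPos D (m · x ⊕ n · y)
  TotPos-combination zero (suc n) {x} {y} p q _ =
    subst (TotPos D) (sym (trans (cong (_⊕ suc n · y) (0-· x)) (⊕-identityˡ _))) (TotPos-· n q)
  TotPos-combination (suc m) zero {x} {y} p q _ =
    subst (TotPos D) (sym (trans (cong (suc m · x ⊕_) (0-· y)) (⊕-identityʳ _))) (TotPos-· m p)
  TotPos-combination (suc m) (suc n) p q _ = TotPos-⊕ (TotPos-· m p) (TotPos-· n q)

  ¬TotPos-zero : ¬ TotPos D zeroK
  ¬TotPos-zero p = refute (subst (λ i → NonNeg (i - + 1)) (zero-homo (trace-linear D)) (trace>0 (TotPos⇒Positive p))) refl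

  combination-nonzero : ∀ m n {x y z} → TotPos D z → z ≡ m · x ⊕ n · y → 1 ℕ.≤ m ℕ.+ n
  combination-nonzero zero zero {x} {y} p refl =
    ⊥-elim (¬TotPos-zero (subst (TotPos D) (cong₂ _⊕_ (0-· x) (0-· y)) p))
  combination-nonzero zero (suc n) _ _ = s≤s z≤n
  combination-nonzero (suc m) n _ _ = s≤s z≤n

equal : ∀ {i j} → i ≡ j → NonNeg (i - j)
equal {i} refl = via nat (sym (ℤₚ.+-inverseʳ i))

+-∸ : ∀ {m n} → n ℕ.≤ m → + (m ℕ.∸ n) ≡ + m - + n
+-∸ {m} {n} n≤m = sym (trans (ℤₚ.m-n≡m⊖n m n) (ℤₚ.⊖-≥ n≤m))

-- Uniquely decomposable elements of a chain

-- The increment is z - y = (p - 2) y + (y - x), so with p ≥ 2 nonnegative increments persist.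
convex-step : ∀ {p x y z} → NonNeg (p - + 2) → x + z ≡ p * y → NonNeg x → NonNeg (y - x) →
              NonNeg (z - y)
convex-step {p} {x} {y} {z} 2≤p eq 0≤x x≤y =
  via (2≤p ⊠ (0≤x ⊞ x≤y) ⊞ x≤y ⊞ equal eq) (solve (p ∷ x ∷ y ∷ z ∷ []))

convex-growth : (h : ℕ → ℤ) (p : ℕ → ℕ) → (∀ k → 2 ℕ.≤ p k) →
  (∀ k → h k + h (2 ℕ.+ k) ≡ + p k * h (1 ℕ.+ k)) →
  NonNeg (h 0) → NonNeg (h 1 - h 0) → ∀ k → NonNeg (h (suc k) - h 1)
convex-growth h p 2≤p rec h₀≥0 h₁≥h₀ = above
  where
  x≤y≤z : ∀ {x y z} → NonNeg (y - x) → NonNeg (z - y) → NonNeg (z - x)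
  x≤y≤z {x} {y} {z} q r = via (q ⊞ r) (solve (x ∷ y ∷ z ∷ []))

  0≤x≤y : ∀ {x y} → NonNeg x → NonNeg (y - x) → NonNeg y
  0≤x≤y {x} {y} q r = via (q ⊞ r) (solve (x ∷ y ∷ []))

  increasing : ∀ k → NonNeg (h k) × NonNeg (h (suc k) - h k)
  increasing zero = h₀≥0 , h₁≥h₀
  increasing (suc k) with increasing k
  ... | q , r = 0≤x≤y {h k} q r , convex-step {+ p k} {h k} (diffℕ (2≤p k)) (rec k) q r

  above : ∀ k → NonNeg (h (suc k) - h 1)
  above zero = equal {h 1} refl
  above (suc k) = x≤y≤z {h 1} {h (suc k)} {h (suc (suc k))} (above k) (proj₂ (increasing (suc k)))

det : OK → OK → ℤ
det x y = a x * b y - b x * a y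

-- `det` is bilinear and alternating, so `det (x ⊕ z) y` is n times `det y y`, which vanishes. Hence
-- the determinant of consecutive terms is constant along a chain.
det-neighbours : ∀ n x y z → x ⊕ z ≡ n · y → det x y ≡ det y z
det-neighbours n (x₁ ω+ x₂) (y₁ ω+ y₂) (z₁ ω+ z₂) eq = begin
  x₁ * y₂ - x₂ * y₁                                   ≡⟨ expand x₁ x₂ y₁ y₂ z₁ z₂ ⟩
  (x₁ + z₁) * y₂ - (x₂ + z₂) * y₁ + (y₁ * z₂ - y₂ * z₁)
    ≡⟨ cong₂ (λ i j → i * y₂ - j * y₁ + (y₁ * z₂ - y₂ * z₁)) (cong a eq) (cong b eq) ⟩
  + n * y₁ * y₂ - + n * y₂ * y₁ + (y₁ * z₂ - y₂ * z₁) ≡⟨ cancel (+ n) y₁ y₂ z₁ z₂ ⟩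
  y₁ * z₂ - y₂ * z₁                                   ∎
  where
  open ≡-Reasoning
  expand : ∀ x₁ x₂ y₁ y₂ z₁ z₂ →
           x₁ * y₂ - x₂ * y₁ ≡ (x₁ + z₁) * y₂ - (x₂ + z₂) * y₁ + (y₁ * z₂ - y₂ * z₁)
  expand = solve-∀
  cancel : ∀ n y₁ y₂ z₁ z₂ →
           n * y₁ * y₂ - n * y₂ * y₁ + (y₁ * z₂ - y₂ * z₁) ≡ y₁ * z₂ - y₂ * z₁
  cancel = solve-∀

-- The indecomposables, ordered along the boundary of the convex hull of O_K⁺ (Hirzebruch–Jung).
record Chain (D : ℕ) : Set where
  field
    β          : ℤ → OK
    c          : ℤ → ℕ
    2≤c        : ∀ m → 2 ℕ.≤ c m
    neighbours : ∀ m → β (ℤ.pred m) ⊕ β (ℤ.suc m) ≡ c m · β m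
    unimodular : ∀ m → det (β m) (β (ℤ.suc m)) ≡ + 1
    β-totPos   : ∀ m → TotPos D (β m)
    span       : ∀ {x} → TotPos D x → ∃[ m ] ∃[ e ] ∃[ f ] x ≡ e · β m ⊕ f · β (ℤ.suc m)

-- Reindexing moves any basis to β 0, β 1. The constructors of ℤ then separate what lies to the left
-- of the basis from what lies to the right.
shift : ∀ {D} → Chain D → ℤ → Chain D
shift C n = record
  { β          = λ m → β (m + n)
  ; c          = λ m → c (m + n)
  ; 2≤c        = λ m → 2≤c (m + n)
  ; neighbours = λ m → subst₂ (λ i j → β i ⊕ β j ≡ c (m + n) · β (m + n))
                   (sym (ℤₚ.+-assoc (- + 1) m n)) (sym (ℤₚ.+-assoc (+ 1) m n)) (neighbours (m + n))
  ; unimodular = λ m → subst (λ i → det (β (m + n)) (β i) ≡ + 1)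
                   (sym (ℤₚ.+-assoc (+ 1) m n)) (unimodular (m + n))
  ; β-totPos   = λ m → β-totPos (m + n)
  ; span       = λ p → let m , e , f , eq = span p in
                   m - n , e , f , trans eq (cong₂ (λ i j → e · β i ⊕ f · β j)
                     (back m n) (back′ m n))
  }
  where
  open Chain C
  back : ∀ m n → m ≡ m - n + n
  back = solve-∀
  back′ : ∀ m n → + 1 + m ≡ + 1 + (m - n) + n
  back′ = solve-∀

-- Given the first two bounds, e + f ≤ p + q - 3 fails only at the corner e = p - 1, f = q - 1.
-- Stating it through the sum lets the functional `S` test it.
Bounded : ℕ → ℕ → ℕ → ℕ → Set
Bounded p q e f = e ℕ.< p × f ℕ.< q × 3 ℕ.+ (e ℕ.+ f) ℕ.≤ p ℕ.+ q

-- Coordinates of a chain in the basis β 0, β 1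

module AtZero {D : ℕ} (C : Chain D) where
  open Chain C

  v w : OK
  v = β (+ 0)
  w = β (+ 1)

  p q : ℕ
  p = c (+ 0)
  q = c (+ 1)

  -- A x and B x are the coordinates of x in the basis v, w, and S = A + B.
  A B S : OK → ℤ
  A x = b w * a x + - a w * b x
  B x = - b v * a x + a v * b x
  S x = (b w - b v) * a x + (a v - a w) * b x

  A-linear : Linear A
  A-linear = functional (b w) (- a w)

  B-linear : Linear B
  B-linear = functional (- b v) (a v)

  S-linear : Linear S
  S-linear = functional (b w - b v) (a v - a w)

  A-v : A v ≡ + 1
  A-v = trans (eq (a v) (b v) (a w) (b w)) (unimodular (+ 0))
    where eq : ∀ a b c d → d * a + - c * b ≡ a * d - b * c
          eq = solve-∀

  A-w : A w ≡ + 0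
  A-w = eq (a w) (b w)
    where eq : ∀ c d → d * c + - c * d ≡ + 0
          eq = solve-∀

  B-v : B v ≡ + 0
  B-v = eq (a v) (b v)
    where eq : ∀ a b → - b * a + a * b ≡ + 0
          eq = solve-∀

  B-w : B w ≡ + 1
  B-w = trans (eq (a v) (b v) (a w) (b w)) (unimodular (+ 0))
    where eq : ∀ a b c d → - b * c + a * d ≡ a * d - b * c
          eq = solve-∀

  S-v : S v ≡ + 1
  S-v = trans (eq (a v) (b v) (a w) (b w)) (unimodular (+ 0))
    where eq : ∀ a b c d → (d - b) * a + (a - c) * b ≡ a * d - b * c
          eq = solve-∀

  S-w : S w ≡ + 1
  S-w = trans (eq (a v) (b v) (a w) (b w)) (unimodular (+ 0))
    where eq : ∀ a b c d → (d - b) * c + (a - c) * d ≡ a * d - b * c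
          eq = solve-∀

  module _ {φ : OK → ℤ} (φ-linear : Linear φ) where

    neighbours-φ : ∀ m → φ (β (ℤ.pred m)) + φ (β (ℤ.suc m)) ≡ + c m * φ (β m)
    neighbours-φ m = trans (sym (⊕-homo φ-linear (β (ℤ.pred m)) (β (ℤ.suc m))))
                    (trans (cong φ (neighbours m)) (·-homo φ-linear (c m) (β m)))

    combination-φ : ∀ {e f} → φ v ≡ e → φ w ≡ f → ∀ m n → φ (m · v ⊕ n · w) ≡ + m * e + + n * f
    combination-φ refl refl m n = combination φ-linear m v n w

    module _ {i j} (φ-v : φ v ≡ i) (φ-w : φ w ≡ j) where

      φ-right : φ (β (+ 2)) ≡ + q * j - i
      φ-right = trans (isolate (φ v) (φ (β (+ 2)))) (cong₂ _-_ (trans (neighbours-φ (+ 1)) (cong (+ q *_) φ-w)) φ-v)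
        where isolate : ∀ i j → j ≡ i + j - i
              isolate = solve-∀

      φ-left : φ (β -[1+ 0 ]) ≡ + p * i - j
      φ-left = trans (isolate (φ w) (φ (β -[1+ 0 ]))) (cong₂ _-_ (trans (neighbours-φ (+ 0)) (cong (+ p *_) φ-v)) φ-w)
        where isolate : ∀ i j → j ≡ j + i - i
              isolate = solve-∀

      -- The growth starts at `w`, so its first increment, q j - i - j, is the one from `w` to β 2.
      -- The values (i , j) = (0 , 1) and (1 , 1) yield the bounds q for `B` and q - 1 for `S`.
      right-growth : NonNeg j → NonNeg (+ q * j - i - j) → ∀ k → NonNeg (φ (β (+ suc (suc k))) - (+ q * j - i))
      right-growth r s k = subst (λ i → NonNeg (φ (β (+ suc (suc k))) - i)) φ-right
        (convex-growth (λ k → φ (β (+ suc k))) (λ k → c (+ suc (suc k))) (λ k → 2≤c _)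
          (λ k → neighbours-φ (+ suc (suc k)))
          (subst NonNeg (sym φ-w) r) (subst₂ (λ i j → NonNeg (i - j)) (sym φ-right) (sym φ-w) s) k)

      left-growth : NonNeg i → NonNeg (+ p * i - j - i) → ∀ k → NonNeg (φ (β -[1+ k ]) - (+ p * i - j))
      left-growth r s k = subst (λ i → NonNeg (φ (β -[1+ k ]) - i)) φ-left
        (convex-growth (λ k → φ (β (- + k))) (λ k → c -[1+ k ]) (λ k → 2≤c _) rec
          (subst NonNeg (sym φ-v) r) (subst₂ (λ i j → NonNeg (i - j)) (sym φ-left) (sym φ-v) s) k)
        where
        rec : ∀ k → φ (β (- + k)) + φ (β -[1+ suc k ]) ≡ + c -[1+ k ] * φ (β -[1+ k ])
        rec zero    = trans (ℤₚ.+-comm (φ v) _) (neighbours-φ -[1+ 0 ])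
        rec (suc k) = trans (ℤₚ.+-comm (φ (β -[1+ k ])) _) (neighbours-φ -[1+ suc k ])

  -- `Left` and `Right` bound the elements beyond `v` and beyond `w`. `Cone` is what a sum of chain
  -- elements retains: `B` can be negative only through a summand on the left, which contributes at
  -- least p - 1 to `S`, and `A` only through one on the right, which contributes at least q - 1. As
  -- `S` is nonnegative on every summand, the condition is stable under addition.
  Left Right Cone : OK → Set
  Left x  = NonNeg (A x - + p) × NonNeg (S x - (+ p - + 1))
  Right x = NonNeg (B x - + q) × NonNeg (S x - (+ q - + 1))
  Cone x  = NonNeg (S x) × (NonNeg (B x) ⊎ NonNeg (S x - (+ p - + 1)))
                         × (NonNeg (A x) ⊎ NonNeg (S x - (+ q - + 1)))

  private
    strip-zero : ∀ {x n} → NonNeg (x - (n * + 1 - + 0)) → NonNeg (x - n)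
    strip-zero {x} {n} r = via r (solve (x ∷ n ∷ []))

    strip-one : ∀ {x n} → NonNeg (x - (n * + 1 - + 1)) → NonNeg (x - (n - + 1))
    strip-one {x} {n} r = via r (solve (x ∷ n ∷ []))

    gap-zero : ∀ {n} → NonNeg (n - + 2) → NonNeg (n * + 1 - + 0 - + 1)
    gap-zero {n} r = via (r ⊞ nat {1}) (solve (n ∷ []))

    gap-one : ∀ {n} → NonNeg (n - + 2) → NonNeg (n * + 1 - + 1 - + 1)
    gap-one {n} r = via r (solve (n ∷ []))

  right : ∀ k → Right (β (+ suc (suc k)))
  right k =
    strip-zero {B (β (+ suc (suc k)))} {+ q} (right-growth B-linear B-v B-w nat (gap-zero {+ q} (diffℕ (2≤c (+ 1)))) k) ,
    strip-one {S (β (+ suc (suc k)))} {+ q} (right-growth S-linear S-v S-w nat (gap-one {+ q} (diffℕ (2≤c (+ 1)))) k)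

  left : ∀ k → Left (β -[1+ k ])
  left k =
    strip-zero {A (β -[1+ k ])} {+ p} (left-growth A-linear A-v A-w nat (gap-zero {+ p} (diffℕ (2≤c (+ 0)))) k) ,
    strip-one {S (β -[1+ k ])} {+ p} (left-growth S-linear S-v S-w nat (gap-one {+ p} (diffℕ (2≤c (+ 0)))) k)

  private
    above-one : ∀ {x n} → NonNeg (n - + 2) → NonNeg (x - (n - + 1)) → NonNeg (x - + 1)
    above-one {x} {n} r s = via (r ⊞ s) (solve (x ∷ n ∷ []))

    above-zero : ∀ {x n} → NonNeg (n - + 2) → NonNeg (x - n) → NonNeg x
    above-zero {x} {n} r s = via (r ⊞ s ⊞ nat {2}) (solve (x ∷ n ∷ []))

    weaken : ∀ {x} → NonNeg (x - + 1) → NonNeg x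
    weaken {x} r = via (r ⊞ nat {1}) (solve (x ∷ []))

  1≤S-β : ∀ m → NonNeg (S (β m) - + 1)
  1≤S-β (+ zero)        = equal S-v
  1≤S-β (+ suc zero)    = equal S-w
  1≤S-β (+ suc (suc k)) = above-one {S (β (+ suc (suc k)))} {+ q} (diffℕ (2≤c (+ 1))) (proj₂ (right k))
  1≤S-β -[1+ k ]        = above-one {S (β -[1+ k ])} {+ p} (diffℕ (2≤c (+ 0))) (proj₂ (left k))

  cone-β : ∀ m → Cone (β m)
  cone-β m = weaken (1≤S-β m) , coordinates m
    where
    coordinates : ∀ m → (NonNeg (B (β m)) ⊎ NonNeg (S (β m) - (+ p - + 1)))
                      × (NonNeg (A (β m)) ⊎ NonNeg (S (β m) - (+ q - + 1)))
    coordinates (+ zero)        = inj₁ (subst NonNeg (sym B-v) nat) , inj₁ (subst NonNeg (sym A-v) nat)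
    coordinates (+ suc zero)    = inj₁ (subst NonNeg (sym B-w) nat) , inj₁ (subst NonNeg (sym A-w) nat)
    coordinates (+ suc (suc k)) = inj₁ (above-zero {B (β (+ suc (suc k)))} {+ q} (diffℕ (2≤c (+ 1))) (proj₁ (right k))) ,
                                  inj₂ (proj₂ (right k))
    coordinates -[1+ k ]        = inj₂ (proj₂ (left k)) ,
                                  inj₁ (above-zero {A (β -[1+ k ])} {+ p} (diffℕ (2≤c (+ 0))) (proj₁ (left k)))

  private
    merge : ∀ {n x y s t} → NonNeg s → NonNeg t → NonNeg x ⊎ NonNeg (s - n) → NonNeg y ⊎ NonNeg (t - n) →
            NonNeg (x + y) ⊎ NonNeg (s + t - n)
    merge _ _ (inj₁ r) (inj₁ r') = inj₁ (r ⊞ r')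
    merge {n} {s = s} {t} 0≤s 0≤t (inj₂ r) _ = inj₂ (via (r ⊞ 0≤t) (solve (n ∷ s ∷ t ∷ [])))
    merge {n} {s = s} {t} 0≤s 0≤t (inj₁ _) (inj₂ r) = inj₂ (via (r ⊞ 0≤s) (solve (n ∷ s ∷ t ∷ [])))

  cone-⊕ : ∀ {x y} → Cone x → Cone y → Cone (x ⊕ y)
  cone-⊕ {x} {y} (s , i , j) (s' , i' , j')
    rewrite ⊕-homo A-linear x y | ⊕-homo B-linear x y | ⊕-homo S-linear x y =
    s ⊞ s' , merge s s' i i' , merge s s' j j'

  cone-zero : Cone zeroK
  cone-zero = subst NonNeg (sym (zero-homo S-linear)) nat ,
              inj₁ (subst NonNeg (sym (zero-homo B-linear)) nat) ,
              inj₁ (subst NonNeg (sym (zero-homo A-linear)) nat)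

  private
    combination≥1 : ∀ {m n s t} → 1 ℕ.≤ m ℕ.+ n → NonNeg (s - + 1) → NonNeg (t - + 1) → NonNeg (+ m * s + + n * t - + 1)
    combination≥1 {m} {n} {s} {t} mn r r' = via (nat {m} ⊠ r ⊞ nat {n} ⊠ r' ⊞ diffℕ mn) (eq (+ m) (+ n) s t)
      where eq : ∀ m n s t → m * (s - + 1) + n * (t - + 1) + (m + n - + 1) ≡ m * s + n * t - + 1
            eq = solve-∀

  1≤S : ∀ {x} → TotPos D x → NonNeg (S x - + 1)
  1≤S {x} x>0 with span x>0
  ... | m , e , f , eq = subst (λ i → NonNeg (i - + 1))
    (sym (trans (cong S eq) (combination S-linear e (β m) f (β (ℤ.suc m)))))
    (combination≥1 {e} {f} (combination-nonzero D e f x>0 eq) (1≤S-β m) (1≤S-β (ℤ.suc m)))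

  -- By `1≤S`, a sum of two totally positive elements has `S` at least 2, whereas `S v` is 1.
  v-indecomposable : Indecomposable D v
  v-indecomposable = β-totPos (+ 0) , λ (y , z , y>0 , z>0 , eq) →
    refute (1≤S y>0 ⊞ 1≤S z>0) (trans (cancel (S y) (S z))
      (cong (_- + 2) (trans (sym (⊕-homo S-linear y z)) (trans (cong S (sym eq)) S-v))))
    where cancel : ∀ i j → i - + 1 + (j - + 1) ≡ i + j - + 2
          cancel = solve-∀

β-indecomposable : ∀ {D} (C : Chain D) m → Indecomposable D (Chain.β C m)
β-indecomposable {D} C m =
  subst (λ i → Indecomposable D (Chain.β C i)) (ℤₚ.+-identityˡ m) (AtZero.v-indecomposable (shift C m))

-- In the representation given by `span`, e + f ≥ 2 would allow splitting off one basis vector and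
-- leave a totally positive rest.
indecomposable⇒β : ∀ {D} (C : Chain D) {x} → Indecomposable D x → ∃[ m ] x ≡ Chain.β C m
indecomposable⇒β {D} C {x} (x>0 , irreducible) with Chain.span C x>0
... | m , e , f , eq = go e f eq
  where
  open Chain C
  split : ∀ {y z} → TotPos D y → TotPos D z → x ≡ y ⊕ z → ∃[ m ] x ≡ β m
  split y>0 z>0 eq = ⊥-elim (irreducible (_ , _ , y>0 , z>0 , eq))

  go : ∀ e f → x ≡ e · β m ⊕ f · β (ℤ.suc m) → ∃[ m ] x ≡ β m
  go zero zero eq = ⊥-elim (ℕₚ.n≮0 (combination-nonzero D 0 0 {β m} {β (ℤ.suc m)} x>0 eq))
  go zero (suc zero) eq = ℤ.suc m , trans eq
    (trans (cong₂ _⊕_ (0-· (β m)) (1-· (β (ℤ.suc m)))) (⊕-identityˡ _))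
  go zero (suc (suc f)) eq = split (β-totPos (ℤ.suc m)) (TotPos-· D f (β-totPos (ℤ.suc m)))
    (trans eq (trans (cong₂ _⊕_ (0-· (β m)) (suc-· (suc f) (β (ℤ.suc m)))) (⊕-identityˡ _)))
  go (suc zero) zero eq = m , trans eq
    (trans (cong₂ _⊕_ (1-· (β m)) (0-· (β (ℤ.suc m)))) (⊕-identityʳ _))
  go (suc (suc e)) f eq = split (β-totPos m)
    (TotPos-combination D (suc e) f (β-totPos m) (β-totPos (ℤ.suc m)) (s≤s z≤n))
    (trans eq (trans (cong (_⊕ f · β (ℤ.suc m)) (suc-· (suc e) (β m)))
      (⊕-assoc (β m) (suc e · β m) (f · β (ℤ.suc m)))))
  go (suc zero) (suc f) eq = split (β-totPos m) (TotPos-· D f (β-totPos (ℤ.suc m)))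
    (trans eq (cong (_⊕ suc f · β (ℤ.suc m)) (1-· (β m))))

-- Here y and s are the coordinate and the sum of a summand beyond the basis vector with bound q, x
-- and s' those of all other summands together, f and t the totals. If x ≥ 0, then f ≥ q; otherwise
-- s' ≥ p - 1 and t ≥ p + q - 2. Both contradict `Bounded`.
excess : ∀ {p q f t x y s s'} → NonNeg (y - q) → NonNeg (s - (q - + 1)) →
         NonNeg x ⊎ NonNeg (s' - (p - + 1)) → y + x ≡ f → s + s' ≡ t →
         NonNeg (q - (+ 1 + f)) → NonNeg (p + q - (+ 3 + t)) → ⊥
excess {p} {q} {f} {t} {x} {y} {s} {s'} y≥q s≥q-1 x⊎s' y+x≡f s+s'≡t f<q t<p+q =
  [ coordinate , total ]′ x⊎s'
  where
  coordinate : NonNeg x → ⊥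
  coordinate 0≤x = refute (y≥q ⊞ 0≤x ⊞ equal (sym y+x≡f) ⊞ f<q) (solve (q ∷ f ∷ x ∷ y ∷ []))
  total : NonNeg (s' - (p - + 1)) → ⊥
  total s'≥p-1 = refute (s≥q-1 ⊞ s'≥p-1 ⊞ equal (sym s+s'≡t) ⊞ t<p+q) (solve (p ∷ q ∷ t ∷ s ∷ s' ∷ []))

-- Used for a multiple of one basis vector from which the other one has been subtracted: the rest
-- has coordinate x = -1, which it can only have with s ≥ q - 1, and then f ≥ q.
deficit : ∀ {q f x s} → NonNeg x ⊎ NonNeg (s - (q - + 1)) → + 1 + x ≡ + 0 → + 1 + s ≡ f →
          NonNeg (q - (+ 1 + f)) → ⊥
deficit {q} {f} {x} {s} x⊎s 1+x≡0 1+s≡f f<q = [ coordinate , total ]′ x⊎s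
  where
  coordinate : NonNeg x → ⊥
  coordinate 0≤x = refute (0≤x ⊞ equal (sym 1+x≡0)) (solve (x ∷ []))
  total : NonNeg (s - (q - + 1)) → ⊥
  total s≥q-1 = refute (s≥q-1 ⊞ equal (sym 1+s≡f) ⊞ f<q) (solve (q ∷ f ∷ s ∷ []))

module _ {D : ℕ} where

  two-decompositions⇒¬UD : ∀ {x} L M {z} → All (Indecomposable D) L → All (Indecomposable D) M →
    sumK L ≡ x → sumK M ≡ x → z ∈ M → ¬ z ∈ L → ¬ UniquelyDecomposable D x
  two-decompositions⇒¬UD L M L-ind M-ind L-sum M-sum z∈M z∉L (_ , N , _ , _ , unique) =
    z∉L (↭ₚ.∈-resp-↭ (↭-trans (unique M M-ind M-sum) (↭-sym (unique L L-ind L-sum))) z∈M)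

-- Uniqueness inside the bounds, second decompositions outside them

module AtZeroUD {D : ℕ} (C : Chain D) where
  open Chain C
  open AtZero C

  copies : ℕ → ℕ → List OK
  copies e f = replicate e v ++ replicate f w

  sumK-copies : ∀ e f → sumK (copies e f) ≡ e · v ⊕ f · w
  sumK-copies e f = trans (sumK-++ (replicate e v) (replicate f w))
                          (cong₂ _⊕_ (sumK-replicate e v) (sumK-replicate f w))

  copies-indecomposable : ∀ e f → All (Indecomposable D) (copies e f)
  copies-indecomposable e f = Allₚ.++⁺
    (Allₚ.replicate⁺ e (β-indecomposable C (+ 0))) (Allₚ.replicate⁺ f (β-indecomposable C (+ 1)))

  ∈-copies : ∀ e f {z} → z ∈ copies e f → z ≡ v ⊎ z ≡ w
  ∈-copies e f = All.lookup {P = λ z → z ≡ v ⊎ z ≡ w} (Allₚ.++⁺ (Allₚ.replicate⁺ e (inj₁ refl)) (Allₚ.replicate⁺ f (inj₂ refl)))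

  sum-cone : ∀ {L} → All (Indecomposable D) L → Cone (sumK L)
  sum-cone All.[] = cone-zero
  sum-cone (x-ind All.∷ L-ind) with indecomposable⇒β C x-ind
  ... | m , refl = cone-⊕ (cone-β m) (sum-cone L-ind)

  private
    φ-copies : ∀ {φ i j} → Linear φ → φ v ≡ i → φ w ≡ j → ∀ {y z} e f → y ⊕ z ≡ e · v ⊕ f · w →
               φ y + φ z ≡ + e * i + + f * j
    φ-copies {φ} φ-linear φ-v φ-w {y} {z} e f eq =
      trans (sym (⊕-homo φ-linear y z)) (trans (cong φ eq) (combination-φ φ-linear φ-v φ-w e f))

    e*1+f*0 : ∀ e f → e * + 1 + f * + 0 ≡ e
    e*1+f*0 = solve-∀
    e*0+f*1 : ∀ e f → e * + 0 + f * + 1 ≡ f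
    e*0+f*1 = solve-∀
    e*1+f*1 : ∀ e f → e * + 1 + f * + 1 ≡ e + f
    e*1+f*1 = solve-∀

  module _ {γ y} e f (eq : γ ⊕ y ≡ e · v ⊕ f · w) where

    A-coordinate : A γ + A y ≡ + e
    A-coordinate = trans (φ-copies A-linear A-v A-w e f eq) (e*1+f*0 (+ e) (+ f))

    B-coordinate : B γ + B y ≡ + f
    B-coordinate = trans (φ-copies B-linear B-v B-w e f eq) (e*0+f*1 (+ e) (+ f))

    S-coordinate : S γ + S y ≡ + e + + f
    S-coordinate = trans (φ-copies S-linear S-v S-w e f eq) (e*1+f*1 (+ e) (+ f))

    ¬right : Bounded p q e f → Right γ → Cone y → ⊥
    ¬right (_ , f<q , t<p+q) (r , r') (_ , r'' , _) =
      excess {+ p} {+ q} {+ f} {+ e + + f} {B y} {B γ} {S γ} {S y}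
        r r' r'' B-coordinate S-coordinate (diffℕ f<q) (diffℕ t<p+q)

    ¬left : Bounded p q e f → Left γ → Cone y → ⊥
    ¬left (e<p , _ , t<p+q) (r , r') (_ , _ , r'') =
      excess {+ q} {+ p} {+ e} {+ e + + f} {A y} {A γ} {S γ} {S y}
        r r' r'' A-coordinate S-coordinate (diffℕ e<p)
        (diffℕ (subst (3 ℕ.+ (e ℕ.+ f) ℕ.≤_) (ℕₚ.+-comm p q) t<p+q))

  ¬v-summand : ∀ {y} f → v ⊕ y ≡ 0 · v ⊕ f · w → f ℕ.< q → Cone y → ⊥
  ¬v-summand {y} f eq f<q (_ , _ , r) = deficit {+ q} {+ f} {A y} {S y} r
    (trans (cong (_+ A y) (sym A-v)) (A-coordinate 0 f eq))
    (trans (cong (_+ S y) (sym S-v)) (S-coordinate 0 f eq)) (diffℕ f<q)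

  ¬w-summand : ∀ {y} e → w ⊕ y ≡ e · v ⊕ 0 · w → e ℕ.< p → Cone y → ⊥
  ¬w-summand {y} e eq e<p (_ , r , _) = deficit {+ p} {+ e} {B y} {S y} r
    (trans (cong (_+ B y) (sym B-w)) (B-coordinate e 0 eq))
    (trans (cong (_+ S y) (sym S-w)) (trans (S-coordinate e 0 eq) (ℤₚ.+-identityʳ (+ e)))) (diffℕ e<p)

  private
    drop-v : ∀ {y} e f → v ⊕ y ≡ suc e · v ⊕ f · w → y ≡ e · v ⊕ f · w
    drop-v e f eq = ⊕-cancelˡ v (trans eq
      (trans (cong (_⊕ f · w) (suc-· e v)) (⊕-assoc v (e · v) (f · w))))

    drop-w : ∀ {y} e f → w ⊕ y ≡ e · v ⊕ suc f · w → y ≡ e · v ⊕ f · w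
    drop-w e f eq = ⊕-cancelˡ w (trans eq (trans (cong (e · v ⊕_) (suc-· f w))
      (trans (sym (⊕-assoc (e · v) w (f · w)))
      (trans (cong (_⊕ f · w) (⊕-comm (e · v) w)) (⊕-assoc w (e · v) (f · w))))))

    bounded-predˡ : ∀ {p q e f} → Bounded p q (suc e) f → Bounded p q e f
    bounded-predˡ (r , s , t) = ℕₚ.<⇒≤ r , s , ℕₚ.<⇒≤ t

    bounded-predʳ : ∀ {p q} e {f} → Bounded p q e (suc f) → Bounded p q e f
    bounded-predʳ {p} {q} e {f} (r , s , t) =
      r , ℕₚ.<⇒≤ s , ℕₚ.<⇒≤ (subst (λ i → 3 ℕ.+ i ℕ.≤ p ℕ.+ q) (ℕₚ.+-suc e f) t)

  -- Induction on the list. Its head is some β m; the tail lies in `Cone`, so `¬right` and `¬left`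
  -- exclude every m other than 0 and 1. A head `v` or `w` is cancelled on both sides, and the
  -- bounds pass to the smaller coefficients.
  only-copies : ∀ L e f → All (Indecomposable D) L → Bounded p q e f → sumK L ≡ e · v ⊕ f · w →
                L ↭ copies e f
  only-copies [] zero zero _ _ _ = ↭-refl
  only-copies [] (suc e) f _ _ eq =
    ⊥-elim (¬TotPos-zero D (subst (TotPos D) (sym eq)
      (TotPos-combination D (suc e) f (β-totPos (+ 0)) (β-totPos (+ 1)) (s≤s z≤n))))
  only-copies [] zero (suc f) _ _ eq =
    ⊥-elim (¬TotPos-zero D (subst (TotPos D) (sym eq)
      (TotPos-combination D 0 (suc f) (β-totPos (+ 0)) (β-totPos (+ 1)) (s≤s z≤n))))
  only-copies (x ∷ L) e f (x-ind All.∷ L-ind) bounded eq with indecomposable⇒β C x-ind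
  ... | + suc (suc k) , refl = ⊥-elim (¬right e f eq bounded (right k) (sum-cone L-ind))
  ... | -[1+ k ] , refl = ⊥-elim (¬left e f eq bounded (left k) (sum-cone L-ind))
  only-copies (x ∷ L) zero f (_ All.∷ L-ind) bounded eq | + zero , refl =
    ⊥-elim (¬v-summand f eq (proj₁ (proj₂ bounded)) (sum-cone L-ind))
  only-copies (x ∷ L) (suc e) f (_ All.∷ L-ind) bounded eq | + zero , refl =
    prep v (only-copies L e f L-ind (bounded-predˡ {p} {q} {e} {f} bounded) (drop-v e f eq))
  only-copies (x ∷ L) e zero (_ All.∷ L-ind) bounded eq | + suc zero , refl =
    ⊥-elim (¬w-summand e eq (proj₁ bounded) (sum-cone L-ind))
  only-copies (x ∷ L) e (suc f) (_ All.∷ L-ind) bounded eq | + suc zero , refl =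
    ↭-trans (prep w (only-copies L e f L-ind (bounded-predʳ {p} {q} e {f} bounded) (drop-w e f eq)))
            (↭-sym (↭ₚ.shift w (replicate e v) (replicate f w)))

  bounded⇒UD : ∀ {x} e f → 1 ℕ.≤ e ℕ.+ f → Bounded p q e f → x ≡ e · v ⊕ f · w →
               UniquelyDecomposable D x
  bounded⇒UD e f 1≤e+f bounded refl =
    TotPos-combination D e f (β-totPos (+ 0)) (β-totPos (+ 1)) 1≤e+f ,
    copies e f , copies-indecomposable e f , sumK-copies e f ,
    λ L L-ind L-sum → only-copies L e f L-ind bounded L-sum

  private
    l r : OK
    l = β -[1+ 0 ]
    r = β (+ 2)

    -- The outer neighbours `l` and `r` each have a coordinate -1, whereas those of `v` and `w` are
    -- nonnegative. So the traded decompositions below contain a genuinely new summand.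
    negative∉copies : ∀ {φ : OK → ℤ} {z i j} → φ v ≡ + i → φ w ≡ + j → φ z ≡ -[1+ 0 ] → ∀ e f → ¬ z ∈ copies e f
    negative∉copies {φ} φ-v φ-w φ-z e f z∈ with ∈-copies e f z∈
    ... | inj₁ refl with trans (sym φ-z) φ-v
    ... | ()
    negative∉copies {φ} φ-v φ-w φ-z e f z∈ | inj₂ refl with trans (sym φ-z) φ-w
    ... | ()

    l∉copies : ∀ e f → ¬ l ∈ copies e f
    l∉copies = negative∉copies {B} {l} {0} {1} B-v B-w (trans (φ-left {B} B-linear B-v B-w) (eq (+ p)))
      where eq : ∀ i → i * + 0 - + 1 ≡ - + 1
            eq = solve-∀

    r∉copies : ∀ e f → ¬ r ∈ copies e f
    r∉copies = negative∉copies {A} {r} {1} {0} A-v A-w (trans (φ-right {A} A-linear A-v A-w) (eq (+ q)))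
      where eq : ∀ i → i * + 0 - + 1 ≡ - + 1
            eq = solve-∀

    ¬UD : ∀ {x y z} e f e' f' m n → x ≡ e · v ⊕ f · w → y ≡ β m → z ≡ β n → ¬ y ∈ copies e f →
          e · v ⊕ f · w ≡ y ⊕ (z ⊕ (e' · v ⊕ f' · w)) → ¬ UniquelyDecomposable D x
    ¬UD {y = y} {z} e f e' f' m n refl refl refl y∉ eq =
      two-decompositions⇒¬UD (copies e f) (y ∷ z ∷ copies e' f')
        (copies-indecomposable e f)
        (β-indecomposable C m All.∷ β-indecomposable C n All.∷ copies-indecomposable e' f')
        (sumK-copies e f)
        (trans (cong (λ s → y ⊕ (z ⊕ s)) (sumK-copies e' f')) (sym eq))
        (here refl) y∉

    isolateˡ : ∀ {i j k : ℤ} → i + j ≡ k → i ≡ k - j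
    isolateˡ {i} {j} refl = sym (trans (ℤₚ.+-assoc i j (- j))
      (trans (cong (_+_ i) (ℤₚ.+-inverseʳ j)) (ℤₚ.+-identityʳ i)))

    isolateʳ : ∀ {i j k : ℤ} → i + j ≡ k → j ≡ k - i
    isolateʳ {i} {j} eq = isolateˡ (trans (ℤₚ.+-comm j i) eq)

    trade-v : ∀ e f → p ℕ.≤ e → e · v ⊕ f · w ≡ l ⊕ (w ⊕ ((e ℕ.∸ p) · v ⊕ f · w))
    trade-v e f p≤e = coordinate (a v) (a w) (a l) (cong a (neighbours (+ 0))) ≐
                        coordinate (b v) (b w) (b l) (cong b (neighbours (+ 0)))
      where
      eq : ∀ e f p v w → e * v + f * w ≡ p * v - w + (w + ((e - p) * v + f * w))
      eq = solve-∀
      coordinate : ∀ v w l → l + w ≡ + p * v → + e * v + + f * w ≡ l + (w + (+ (e ℕ.∸ p) * v + + f * w))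
      coordinate v w l l+w = trans (eq (+ e) (+ f) (+ p) v w)
        (sym (cong₂ (λ i k → i + (w + (k * v + + f * w))) (isolateˡ {l} {w} l+w) (+-∸ p≤e)))

    trade-w : ∀ e f → q ℕ.≤ f → e · v ⊕ f · w ≡ r ⊕ (v ⊕ (e · v ⊕ (f ℕ.∸ q) · w))
    trade-w e f q≤f = coordinate (a v) (a w) (a r) (cong a (neighbours (+ 1))) ≐
                        coordinate (b v) (b w) (b r) (cong b (neighbours (+ 1)))
      where
      eq : ∀ e f q v w → e * v + f * w ≡ q * w - v + (v + (e * v + (f - q) * w))
      eq = solve-∀
      coordinate : ∀ v w r → v + r ≡ + q * w → + e * v + + f * w ≡ r + (v + (+ e * v + + (f ℕ.∸ q) * w))
      coordinate v w r v+r = trans (eq (+ e) (+ f) (+ q) v w)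
        (sym (cong₂ (λ i k → i + (v + (+ e * v + k * w))) (isolateʳ {v} {r} v+r) (+-∸ q≤f)))

    -- Adding l + w = p v and v + r = q w gives l + r = (p - 1) v + (q - 1) w, the excluded corner;
    -- hence the remaining coefficients e + 1 - p and f + 1 - q.
    trade-both : ∀ e f → p ℕ.≤ suc e → q ℕ.≤ suc f →
                 e · v ⊕ f · w ≡ l ⊕ (r ⊕ ((suc e ℕ.∸ p) · v ⊕ (suc f ℕ.∸ q) · w))
    trade-both e f p≤e q≤f =
      coordinate (a v) (a w) (a l) (a r) (cong a (neighbours (+ 0))) (cong a (neighbours (+ 1))) ≐
      coordinate (b v) (b w) (b l) (b r) (cong b (neighbours (+ 0))) (cong b (neighbours (+ 1)))
      where
      eq : ∀ e f p q v w → e * v + f * w ≡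
           p * v - w + (q * w - v + ((+ 1 + e - p) * v + (+ 1 + f - q) * w))
      eq = solve-∀
      coordinate : ∀ v w l r → l + w ≡ + p * v → v + r ≡ + q * w →
        + e * v + + f * w ≡ l + (r + (+ (suc e ℕ.∸ p) * v + + (suc f ℕ.∸ q) * w))
      coordinate v w l r l+w v+r = trans (eq (+ e) (+ f) (+ p) (+ q) v w)
        (sym (cong₂ _+_ (isolateˡ {l} {w} l+w) (cong₂ _+_ (isolateʳ {v} {r} v+r)
          (cong₂ (λ i k → i * v + k * w) (+-∸ p≤e) (+-∸ q≤f)))))

  UD⇒bounded : ∀ {x} e f → x ≡ e · v ⊕ f · w → UniquelyDecomposable D x → Bounded p q e f
  UD⇒bounded e f eq ud with e ℕ.<? p | f ℕ.<? q
  ... | no e≮p | _ = ⊥-elim (¬UD e f (e ℕ.∸ p) f -[1+ 0 ] (+ 1) eq refl refl (l∉copies e f)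
                       (trade-v e f (ℕₚ.≮⇒≥ e≮p)) ud)
  ... | yes _ | no f≮q = ⊥-elim (¬UD e f e (f ℕ.∸ q) (+ 2) (+ 0) eq refl refl (r∉copies e f)
                       (trade-w e f (ℕₚ.≮⇒≥ f≮q)) ud)
  ... | yes e<p | yes f<q with 3 ℕ.+ (e ℕ.+ f) ℕ.≤? p ℕ.+ q
  ...   | yes t<p+q = e<p , f<q , t<p+q
  ...   | no t≮p+q = ⊥-elim (¬UD e f (suc e ℕ.∸ p) (suc f ℕ.∸ q) -[1+ 0 ] (+ 2) eq refl refl (l∉copies e f)
                       (trade-both e f (tight e<p f<q t≮p+q)
                         (tight f<q e<p (λ t → t≮p+q (subst₂ (λ i j → 3 ℕ.+ i ℕ.≤ j)
                           (ℕₚ.+-comm f e) (ℕₚ.+-comm q p) t)))) ud)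
    where
    -- If the third bound fails while the first two hold, then e = p - 1; with the roles exchanged,
    -- f = q - 1.
    tight : ∀ {e f p q} → e ℕ.< p → f ℕ.< q → ¬ (3 ℕ.+ (e ℕ.+ f) ℕ.≤ p ℕ.+ q) → p ℕ.≤ suc e
    tight {e} {f} {p} {q} _ f<q ¬t = ℕₚ.≮⇒≥ λ e+1<p → ¬t
      (subst (ℕ._≤ p ℕ.+ q) (cong (λ i → suc (suc i)) (ℕₚ.+-suc e f)) (ℕₚ.+-mono-≤ e+1<p f<q))

module _ {D : ℕ} (C : Chain D) where
  open Chain C

  UD⇔bounded : ∀ x → UniquelyDecomposable D x ⇔
    (∃[ m ] ∃[ e ] ∃[ f ] (1 ℕ.≤ e ℕ.+ f × Bounded (c m) (c (ℤ.suc m)) e f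
                           × x ≡ e · β m ⊕ f · β (ℤ.suc m)))
  UD⇔bounded x = mk⇔ to from
    where
    -- The basis of the shifted chain has indices `+ 0 + m` and `+ 1 + m`. The second is `ℤ.suc m`
    -- by definition, so only the first needs transport.
    at : ∀ m → (P : ℤ → Set) → P (+ 0 + m) ⇔ P m
    at m P = mk⇔ (subst P (ℤₚ.+-identityˡ m)) (subst P (sym (ℤₚ.+-identityˡ m)))
    open Function.Bundles.Equivalence using () renaming (to to fwd; from to bwd)

    to : _
    to ud with span (proj₁ ud)
    ... | m , e , f , eq = m , e , f , combination-nonzero D e f (proj₁ ud) eq ,
      fwd (at m λ i → Bounded (c i) (c (ℤ.suc m)) e f)
        (AtZeroUD.UD⇒bounded (shift C m) e f
          (bwd (at m λ i → x ≡ e · β i ⊕ f · β (ℤ.suc m)) eq) ud) , eq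

    from : _
    from (m , e , f , 1≤e+f , bounded , eq) = AtZeroUD.bounded⇒UD (shift C m) e f 1≤e+f
      (bwd (at m λ i → Bounded (c i) (c (ℤ.suc m)) e f) bounded)
      (bwd (at m λ i → x ≡ e · β i ⊕ f · β (ℤ.suc m)) eq)

-- The continued fraction of σ_D

isqrt-bounds : ∀ n → isqrt n ℕ.* isqrt n ℕ.≤ n × n ℕ.< suc (isqrt n) ℕ.* suc (isqrt n)
isqrt-bounds zero = z≤n , s≤s z≤n
isqrt-bounds (suc n) with isqrt n | isqrt-bounds n
... | s | s²≤n , n<[s+1]² with (suc s ℕ.* suc s) ≤ᵇ suc n in eq
...   | true  = ℕₚ.≤ᵇ⇒≤ _ _ (subst T (sym eq) tt) ,
                ℕₚ.≤-<-trans n<[s+1]² (ℕₚ.*-mono-< (ℕₚ.n<1+n (suc s)) (ℕₚ.n<1+n (suc s)))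
...   | false = ℕₚ.m≤n⇒m≤1+n s²≤n , ℕₚ.≰⇒> λ le → subst T eq (ℕₚ.≤⇒≤ᵇ le)

floor-bounds : ∀ m q → let n = m / suc q in
  NonNeg (+ m - + n * + suc q) × NonNeg (+ n * + suc q + + suc q - + m - + 1)
floor-bounds m q =
  subst (λ i → NonNeg (+ m - i)) (ℤₚ.pos-* n (suc q)) (diffℕ (DivMod.m/n*n≤m m (suc q))) ,
  subst₂ (λ i j → NonNeg (i + + suc q - j - + 1)) (ℤₚ.pos-* n (suc q))
    (sym (cong +_ (DivMod.m≡m%n+[m/n]*n m (suc q))))
    (via (diffℕ (DivMod.m%n<n m (suc q))) (eq (+ (m % suc q)) (+ (n ℕ.* suc q)) (+ suc q)))
  where
  n = m / suc q
  eq : ∀ r i k → k - (+ 1 + r) ≡ i + k - (r + i) - + 1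
  eq = solve-∀

nonNeg⇒ℕ : ∀ {i} → NonNeg i → ∃[ n ] i ≡ + n
nonNeg⇒ℕ {+ n} _ = n , refl

-- (P + √d)/Q is a reduced quadratic surd, s being the integer part of √d.
record Reduced (d s P Q : ℤ) : Set where
  field
    P≥1   : NonNeg (P - + 1)
    P≤s   : NonNeg (s - P)
    P+Q>s : NonNeg (P + Q - s - + 1)
    Q≤P+s : NonNeg (P + s - Q)
    R     : ℤ
    split : P * P + Q * R ≡ d

  Q≥1 : NonNeg (Q - + 1)
  Q≥1 = via (P+Q>s ⊞ P≤s) (solve (P ∷ Q ∷ s ∷ []))

module _ {d s : ℤ} (s≥0 : NonNeg s) (s²<d : NonNeg (d - s * s - + 1))
         (d<[s+1]² : NonNeg ((s + + 1) * (s + + 1) - d - + 1)) where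

  module _ {P Q U : ℤ} (red : Reduced d s P Q) (floor≤ : NonNeg (P + s - U * Q))
           (<floor+1 : NonNeg (U * Q + Q - (P + s) - + 1)) where
    open Reduced red

    floor≥1 : NonNeg (U - + 1)
    floor≥1 = *-cancel-pos {Q} {U} Q≥1 (via (<floor+1 ⊞ Q≤P+s) (solve (P ∷ Q ∷ U ∷ s ∷ [])))

    -- If Q ≤ P, then U Q > P + s - Q and s ≥ P ≥ Q suffice; if P < Q, then U ≥ 1 gives U Q ≥ Q > P.
    P<U*Q : NonNeg (U * Q - P - + 1)
    P<U*Q = [ small-Q , large-Q ]′ (decide (P - Q))
      where
      small-Q : NonNeg (P - Q) → NonNeg (U * Q - P - + 1)
      small-Q Q≤P = via (<floor+1 ⊞ P≤s ⊞ Q≤P) (solve (P ∷ Q ∷ U ∷ s ∷ []))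
      large-Q : NonNeg (- (P - Q) - + 1) → NonNeg (U * Q - P - + 1)
      large-Q P<Q = via (floor≥1 ⊠ (Q≥1 ⊞ nat {1}) ⊞ P<Q) (solve (P ∷ Q ∷ U ∷ []))

    private
      P′ R′ : ℤ
      P′ = U * Q - P
      -- This is (d - P′²) / Q written without division, since P′² - P² = U Q (P′ - P).
      R′ = R + U * (P - (U * Q - P))

    split′ : P′ * P′ + Q * R′ ≡ d
    split′ = trans (eq P Q R U) split
      where eq : ∀ P Q R U → (U * Q - P) * (U * Q - P) + Q * (R + U * (P - (U * Q - P))) ≡ P * P + Q * R
            eq = solve-∀

    -- The product Q R′ = d - P′² lies strictly between s² - P′² and (s + 1)² - P′². Since Q ≤ P′ +
    -- s, having R′ ≤ s - P′ would make it too small; since Q ≥ s + 1 - P′, having R′ ≥ s + 1 + P′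
    -- would make it too large.
    next-Reduced : ∀ {P′ R′} → P′ ≡ U * Q - P → P′ * P′ + Q * R′ ≡ d → Reduced d s P′ R′
    next-Reduced {P′} {R′} refl eq = record
      { P≥1   = P<U*Q
      ; P≤s   = P′≤s
      ; P+Q>s = from-contra (P′ + R′ - s - + 1) λ lt → refute
          ((Q≤P′+s ⊠ R′≥0) ⊞ (s≥0 ⊞ P′≥0) ⊠ lt ⊞ equal eq ⊞ s²<d)
          (eq₁ P Q U s d R′)
      ; Q≤P+s = from-contra (P′ + s - R′) λ lt → refute
          ((P′+Q>s ⊠ R′≥0) ⊞ (P′≤s ⊞ nat {1}) ⊠ lt ⊞ equal (sym eq) ⊞ d<[s+1]²)
          (eq₂ P Q U s d R′)
      ; R     = Q
      ; split = trans (cong (_+_ (P′ * P′)) (ℤₚ.*-comm R′ Q)) eq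
      }
      where
      P′≥0 : NonNeg (U * Q - P)
      P′≥0 = via (P<U*Q ⊞ nat {1}) (solve (P ∷ Q ∷ U ∷ []))
      P′≤s : NonNeg (s - (U * Q - P))
      P′≤s = via floor≤ (solve (P ∷ Q ∷ U ∷ s ∷ []))
      P′+Q>s : NonNeg ((U * Q - P) + Q - s - + 1)
      P′+Q>s = via <floor+1 (solve (P ∷ Q ∷ U ∷ s ∷ []))
      Q≤P′+s : NonNeg ((U * Q - P) + s - Q)
      Q≤P′+s = via (floor≥1 ⊠ (Q≥1 ⊞ nat {1}) ⊞ P≤s) (solve (P ∷ Q ∷ U ∷ s ∷ []))
      R′≥1 : NonNeg (R′ - + 1)
      R′≥1 = *-cancel-pos {Q} {R′} Q≥1 (via (P′≤s ⊠ (s≥0 ⊞ P′≥0) ⊞ s²<d ⊞ equal eq) (solve (P ∷ Q ∷ U ∷ s ∷ d ∷ R′ ∷ [])))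
      R′≥0 : NonNeg R′
      R′≥0 = via (R′≥1 ⊞ nat {1}) (solve (R′ ∷ []))
      eq₁ : ∀ P Q U s d R → (U * Q - P + s - Q) * R + (s + (U * Q - P)) * (- (U * Q - P + R - s - + 1) - + 1)
              + ((U * Q - P) * (U * Q - P) + Q * R - d) + (d - s * s - + 1) ≡ - + 1
      eq₁ = solve-∀
      eq₂ : ∀ P Q U s d R → (U * Q - P + Q - s - + 1) * R
              + (s - (U * Q - P) + + 1) * (- (U * Q - P + s - R) - + 1)
              + (d - ((U * Q - P) * (U * Q - P) + Q * R)) + ((s + + 1) * (s + + 1) - d - + 1) ≡ - + 1
      eq₂ = solve-∀

    R′≥1 : NonNeg (R′ - + 1)
    R′≥1 = Reduced.Q≥1 (next-Reduced refl split′)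

-- Proportional pairs and the alternation of norms

module _ {d : ℤ} where

  private
    vanish : ∀ {i j} → i ≡ j → ∀ k → k * (i - j) ≡ + 0
    vanish {i} refl k = trans (cong (k *_) (ℤₚ.+-inverseʳ i)) (ℤₚ.*-zeroʳ k)

  -- Q(X + Y√d) = (√d - P)(X′ + Y′√d).
  record Proportional (P Q X Y X′ Y′ : ℤ) : Set where
    constructor proportional
    field
      rational   : Q * X ≡ d * Y′ - P * X′
      irrational : Q * Y ≡ X′ - P * Y′

  -- Multiplicativity of the norm, with N(√d - P) = -(d - P²): for P² < d this reverses the sign.
  norms : ∀ {P Q X Y X′ Y′} → Proportional P Q X Y X′ Y′ →
          Q * Q * (X * X - d * (Y * Y)) ≡ (d - P * P) * - (X′ * X′ - d * (Y′ * Y′))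
  norms {P} {Q} {X} {Y} {X′} {Y′} (proportional eq eq′) = trans (expand Q X Y d)
    (trans (cong₂ (λ i j → i * i - d * (j * j)) eq eq′) (collect P d X′ Y′))
    where
    expand : ∀ Q X Y d → Q * Q * (X * X - d * (Y * Y)) ≡ Q * X * (Q * X) - d * (Q * Y * (Q * Y))
    expand = solve-∀
    collect : ∀ P d X Y → (d * Y - P * X) * (d * Y - P * X) - d * ((X - P * Y) * (X - P * Y))
                          ≡ (d - P * P) * - (X * X - d * (Y * Y))
    collect = solve-∀

  -- Write α, α′, α″ for the three elements. From Q α = (√d - P) α′ follows Q α″ = (U Q - P + √d) α′
  -- = (√d + P′) α′. Multiplying by √d - P′ gives Q (√d - P′) α″ = (d - P′²) α′ = Q Q′ α′. The
  -- identities `eq₁` and `eq₂` are the two components of this, before Q is cancelled.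
  proportional-step : ∀ {P Q P′ Q′ U X Y X′ Y′ X″ Y″} → NonNeg (Q - + 1) →
    P′ + P ≡ U * Q → P′ * P′ + Q * Q′ ≡ d → X″ ≡ U * X′ + X → Y″ ≡ U * Y′ + Y →
    Proportional P Q X Y X′ Y′ → Proportional P′ Q′ X′ Y′ X″ Y″
  proportional-step {P} {Q} {P′} {Q′} {U} {X} {Y} {X′} {Y′} Q≥1 e₃ e₄ refl refl (proportional e₁ e₂) =
    proportional
      (cancel (trans (eq₁ P Q P′ Q′ U X Y X′ Y′ d) (zeros (vanish e₄ X′) (vanish e₂ (- d)) (vanish e₁ P′)
        (vanish e₃ (d * Y′ - P′ * X′)))))
      (cancel (trans (eq₂ P Q P′ Q′ U X Y X′ Y′ d) (zeros (vanish e₄ Y′) (vanish e₁ (- + 1)) (vanish e₂ P′)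
        (vanish e₃ (X′ - P′ * Y′)))))
    where
    zeros : ∀ {i j k l} → i ≡ + 0 → j ≡ + 0 → k ≡ + 0 → l ≡ + 0 → i + j + k + l ≡ + 0
    zeros refl refl refl refl = refl

    cancel : ∀ {i j} → Q * i - Q * j ≡ + 0 → i ≡ j
    cancel {i} {j} eq = ℤₚ.*-cancelˡ-≡ Q i j {{ℤ.≢-nonZero {Q} λ { refl → refute Q≥1 refl }}}
                          (ℤₚ.i-j≡0⇒i≡j (Q * i) (Q * j) eq)

    eq₁ : ∀ P Q P′ Q′ U X Y X′ Y′ d →
      Q * (Q′ * X′) - Q * (d * (U * Y′ + Y) - P′ * (U * X′ + X)) ≡
      X′ * (P′ * P′ + Q * Q′ - d) + - d * (Q * Y - (X′ - P * Y′)) + P′ * (Q * X - (d * Y′ - P * X′))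
        + (d * Y′ - P′ * X′) * (P′ + P - U * Q)
    eq₁ = solve-∀

    eq₂ : ∀ P Q P′ Q′ U X Y X′ Y′ d →
      Q * (Q′ * Y′) - Q * (U * X′ + X - P′ * (U * Y′ + Y)) ≡
      Y′ * (P′ * P′ + Q * Q′ - d) + - + 1 * (Q * X - (d * Y′ - P * X′)) + P′ * (Q * Y - (X′ - P * Y′))
        + (X′ - P′ * Y′) * (P′ + P - U * Q)
    eq₂ = solve-∀

  norm-flip : ∀ {P Q N N′} → NonNeg (Q - + 1) → NonNeg (d - P * P - + 1) →
              Q * Q * N ≡ (d - P * P) * - N′ → NonNeg (N - + 1) → NonNeg (- N′ - + 1)
  norm-flip {P} {Q} {N} {N′} Q≥1 P²<d eq N≥1 = *-cancel-pos {d - P * P} { - N′} P²<d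
    (subst (λ i → NonNeg (i - + 1)) eq
      (via ((Q≥1 ⊞ nat {1}) ⊠ (Q≥1 ⊞ nat {1}) ⊠ N≥1 ⊞ Q≥1 ⊠ Q≥1 ⊞ nat {2} ⊠ Q≥1) (solve (Q ∷ N ∷ []))))

-- Correctness of the computed states and quotients

module ContinuedFraction (D : ℕ) (2≤D : 2 ℕ.≤ D) (D-squareFree : SquareFree D) where

  s : ℕ
  s = isqrt D

  -- If D were s², squarefreeness would force s = 1, contrary to D ≥ 2.
  s²≢D : s ℕ.* s ≢ D
  s²≢D eq with D-squareFree s (divides 1 (trans (sym eq) (sym (ℕₚ.*-identityˡ (s ℕ.* s)))))
  ... | s≡1 = ℕₚ.<⇒≢ 2≤D (trans (cong₂ ℕ._*_ (sym s≡1) (sym s≡1)) eq)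

  s²<D : NonNeg (+ D - + s * + s - + 1)
  s²<D = via (diffℕ (ℕₚ.≤∧≢⇒< (proj₁ (isqrt-bounds D)) s²≢D))
    (trans (eq (+ D) (+ (s ℕ.* s))) (cong (λ i → + D - i - + 1) (ℤₚ.pos-* s s)))
    where eq : ∀ i j → i - (+ 1 + j) ≡ i - j - + 1
          eq = solve-∀

  D<[s+1]² : NonNeg ((+ s + + 1) * (+ s + + 1) - + D - + 1)
  D<[s+1]² = via (diffℕ (proj₂ (isqrt-bounds D)))
    (trans (cong (_- + suc D) (ℤₚ.pos-* (suc s) (suc s))) (eq (+ s) (+ D)))
    where eq : ∀ s d → (+ 1 + s) * (+ 1 + s) - (+ 1 + d) ≡ (s + + 1) * (s + + 1) - d - + 1
          eq = solve-∀

  1≤s : NonNeg (+ s - + 1)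
  1≤s with s | proj₂ (isqrt-bounds D)
  ... | zero  | D<1 = ⊥-elim (ℕₚ.<⇒≱ D<1 (ℕₚ.<⇒≤ 2≤D))
  ... | suc n | _   = via (nat {n}) (eq (+ n))
    where eq : ∀ i → i ≡ + 1 + i - + 1
          eq = solve-∀

  P Q : ℕ → ℕ
  P i = proj₁ (cfState D i)
  Q i = proj₂ (cfState D i)

  Reducedₙ : ℕ → Set
  Reducedₙ i = Reduced (+ D) (+ s) (+ P i) (+ Q i)

  div-floor : ∀ m q → NonNeg (+ q - + 1) →
    NonNeg (+ m - + (m div q) * + q) × NonNeg (+ (m div q) * + q + + q - + m - + 1)
  div-floor m zero 1≤0 = ⊥-elim (refute 1≤0 refl)
  div-floor m (suc q) _ = floor-bounds m q

  exact-div : ∀ m q n → NonNeg (+ q - + 1) → m ≡ q ℕ.* n → m div q ≡ n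
  exact-div m zero n 1≤0 _ = ⊥-elim (refute 1≤0 refl)
  exact-div m (suc q) n _ refl =
    trans (cong (_/ suc q) (ℕₚ.*-comm (suc q) n)) (DivMod.m*n/n≡m n (suc q))

  -- Makes the truncated subtraction in `cfStep` an integer subtraction; the hypothesis comes from
  -- `P<U*Q`.
  +-*-∸ : ∀ m n k → NonNeg (+ m * + n - + k - + 1) → + (m ℕ.* n ℕ.∸ k) ≡ + m * + n - + k
  +-*-∸ m n k lt = trans (+-∸ {m ℕ.* n} {k} (undiffℕ (via (lt ⊞ nat {1})
      (trans (eq (+ m * + n) (+ k)) (cong (_- + k) (sym (ℤₚ.pos-* m n))))))) (cong (_- + k) (ℤₚ.pos-* m n))
    where eq : ∀ i j → i - j - + 1 + + 1 ≡ i - j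
          eq = solve-∀

  module Step (i : ℕ) (red : Reducedₙ i) where

    floor≤ : NonNeg (+ P i + + s - + u D i * + Q i)
    floor≤ = proj₁ (div-floor (P i ℕ.+ s) (Q i) (Reduced.Q≥1 red))

    <floor+1 : NonNeg (+ u D i * + Q i + + Q i - (+ P i + + s) - + 1)
    <floor+1 = proj₂ (div-floor (P i ℕ.+ s) (Q i) (Reduced.Q≥1 red))

    P-suc : + P (suc i) ≡ + u D i * + Q i - + P i
    P-suc = +-*-∸ (u D i) (Q i) (P i) (P<U*Q nat s²<D D<[s+1]² {U = + u D i} red floor≤ <floor+1)

    split : + P (suc i) * + P (suc i) + + Q i * + Q (suc i) ≡ + D
    split = trans (cong (λ j → + P (suc i) * + P (suc i) + + Q i * + j) Q-suc) D-split
      where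
      cancel : ∀ i → i - + 1 + + 1 ≡ i
      cancel = solve-∀
      -- The integer cofactor is positive, hence a natural number n with D = P′² + Q n; so the
      -- division in `cfStep` is exact and returns n.
      nonNeg-R′ : ∃[ n ] _ ≡ + n
      nonNeg-R′ = nonNeg⇒ℕ (via (R′≥1 nat s²<D D<[s+1]² {U = + u D i} red floor≤ <floor+1 ⊞ nat {1}) (cancel _))
      n : ℕ
      n = proj₁ nonNeg-R′
      D-split : + P (suc i) * + P (suc i) + + Q i * + n ≡ + D
      D-split = trans (cong₂ (λ j k → j * j + + Q i * k) P-suc (sym (proj₂ nonNeg-R′)))
                      (split′ nat s²<D D<[s+1]² {U = + u D i} red floor≤ <floor+1)
      D-splitℕ : P (suc i) ℕ.* P (suc i) ℕ.+ Q i ℕ.* n ≡ D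
      D-splitℕ = ℤₚ.+-injective (trans (cong₂ _+_ (ℤₚ.pos-* (P (suc i)) (P (suc i))) (ℤₚ.pos-* (Q i) n)) D-split)
      Q-suc : Q (suc i) ≡ n
      Q-suc = exact-div (D ℕ.∸ P (suc i) ℕ.* P (suc i)) (Q i) n (Reduced.Q≥1 red)
        (trans (cong (ℕ._∸ P (suc i) ℕ.* P (suc i)) (sym D-splitℕ))
               (ℕₚ.m+n∸m≡n (P (suc i) ℕ.* P (suc i)) (Q i ℕ.* n)))

    reduced-suc : Reducedₙ (suc i)
    reduced-suc = next-Reduced nat s²<D D<[s+1]² {U = + u D i} red floor≤ <floor+1 P-suc split

    u≥1 : 1 ℕ.≤ u D i
    u≥1 = undiffℕ (floor≥1 nat s²<D D<[s+1]² {U = + u D i} red floor≤ <floor+1)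

  -- For D ≡ 1 mod 4 this is ⌊-ω′⌋, and 2 t + 1 is the largest odd number not exceeding s.
  t : ℕ
  t = (s ℕ.∸ 1) / 2

  2t<s : NonNeg (+ s - + 1 - + 2 * + t)
  2t<s = via (proj₁ (floor-bounds (s ℕ.∸ 1) 1))
    (trans (cong (_- + t * + 2) (+-∸ {s} {1} (undiffℕ 1≤s))) (cong (λ i → + s - + 1 - i) (ℤₚ.*-comm (+ t) (+ 2))))

  s≤2t+2 : NonNeg (+ 2 * + t + + 2 - + s)
  s≤2t+2 = via (proj₂ (floor-bounds (s ℕ.∸ 1) 1))
    (trans (cong (λ i → + t * + 2 + + 2 - i - + 1) (+-∸ {s} {1} (undiffℕ 1≤s))) (eq (+ s) (+ t)))
    where eq : ∀ s t → t * + 2 + + 2 - (s - + 1) - + 1 ≡ + 2 * t + + 2 - s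
          eq = solve-∀

  cfInit-1mod4 : is1mod4 D ≡ true → cfInit D ≡ (2 ℕ.* t ℕ.+ 1 , 2)
  cfInit-1mod4 eq rewrite eq = refl

  cfInit-else : is1mod4 D ≡ false → cfInit D ≡ (s , 1)
  cfInit-else eq rewrite eq = refl

  +[2t+1] : + (2 ℕ.* t ℕ.+ 1) ≡ + 2 * + t + + 1
  +[2t+1] = cong (_+ + 1) (ℤₚ.pos-* 2 t)

  D≡1+4k : is1mod4 D ≡ true → + D ≡ + 1 + + 4 * + (D / 4)
  D≡1+4k eq = trans (cong +_ (DivMod.m≡m%n+[m/n]*n D 4))
    (trans (cong (λ r → + (r ℕ.+ D / 4 ℕ.* 4)) (ℕₚ.≡ᵇ⇒≡ (D % 4) 1 (subst T (sym eq) tt)))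
           (cong (_+_ (+ 1)) (trans (ℤₚ.pos-* (D / 4) 4) (ℤₚ.*-comm (+ (D / 4)) (+ 4)))))

  reduced₀-else : Reduced (+ D) (+ s) (+ s) (+ 1)
  reduced₀-else = record
    { P≥1 = 1≤s ; P≤s = via nat (eq₀ (+ s)) ; P+Q>s = via nat (eq₁ (+ s))
    ; Q≤P+s = via (1≤s ⊞ nat {s}) (eq₂ (+ s)) ; R = + D - + s * + s ; split = eq₃ (+ s) (+ D) }
    where
    eq₀ : ∀ s → + 0 ≡ s - s
    eq₀ = solve-∀
    eq₁ : ∀ s → + 0 ≡ s + + 1 - s - + 1
    eq₁ = solve-∀
    eq₂ : ∀ s → s - + 1 + s ≡ s + s - + 1
    eq₂ = solve-∀
    eq₃ : ∀ s d → s * s + + 1 * (d - s * s) ≡ d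
    eq₃ = solve-∀

  reduced₀-1mod4 : is1mod4 D ≡ true → Reduced (+ D) (+ s) (+ 2 * + t + + 1) (+ 2)
  reduced₀-1mod4 eq = record
    { P≥1 = via (nat {2} ⊠ nat {t}) (eq₀ (+ t)) ; P≤s = via 2t<s (eq₁ (+ s) (+ t))
    ; P+Q>s = via s≤2t+2 (eq₂ (+ s) (+ t))
    ; Q≤P+s = via (nat {2} ⊠ nat {t} ⊞ 1≤s) (eq₃ (+ s) (+ t))
    -- With k = D / 4, D - (2 t + 1)² = 4 (k - t² - t), and Q is 2.
    ; R = + 2 * (+ (D / 4) - + t * + t - + t) ; split = trans (eq₄ (+ t) (+ (D / 4))) (sym (D≡1+4k eq)) }
    where
    eq₀ : ∀ t → + 2 * t ≡ + 2 * t + + 1 - + 1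
    eq₀ = solve-∀
    eq₁ : ∀ s t → s - + 1 - + 2 * t ≡ s - (+ 2 * t + + 1)
    eq₁ = solve-∀
    eq₂ : ∀ s t → + 2 * t + + 2 - s ≡ + 2 * t + + 1 + + 2 - s - + 1
    eq₂ = solve-∀
    eq₃ : ∀ s t → + 2 * t + (s - + 1) ≡ + 2 * t + + 1 + s - + 2
    eq₃ = solve-∀
    eq₄ : ∀ t k → (+ 2 * t + + 1) * (+ 2 * t + + 1) + + 2 * (+ 2 * (k - t * t - t)) ≡ + 1 + + 4 * k
    eq₄ = solve-∀

  1mod4? : (is1mod4 D ≡ true) ⊎ (is1mod4 D ≡ false)
  1mod4? with is1mod4 D
  ... | true  = inj₁ refl
  ... | false = inj₂ refl

  reduced₀ : Reducedₙ 0
  reduced₀ with 1mod4?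
  ... | inj₁ eq rewrite cfInit-1mod4 eq =
    subst (λ P → Reduced (+ D) (+ s) P (+ 2)) (sym +[2t+1]) (reduced₀-1mod4 eq)
  ... | inj₂ eq rewrite cfInit-else eq = reduced₀-else

  reduced : ∀ i → Reducedₙ i
  reduced zero = reduced₀
  reduced (suc i) = Step.reduced-suc i (reduced i)

  1≤u : ∀ i → 1 ℕ.≤ u D i
  1≤u i = Step.u≥1 i (reduced i)

  u₀-else : is1mod4 D ≡ false → u D 0 ≡ s ℕ.+ s
  u₀-else eq rewrite cfInit-else eq = DivMod.n/1≡n (s ℕ.+ s)

  -- Since s is 2 t + 1 or 2 t + 2, the numerator is 4 t + 2 or 4 t + 3.
  u₀-1mod4 : is1mod4 D ≡ true → u D 0 ≡ 2 ℕ.* t ℕ.+ 1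
  u₀-1mod4 eq rewrite cfInit-1mod4 eq with (2 ℕ.* t ℕ.+ 1 ℕ.+ s) / 2 | floor-bounds (2 ℕ.* t ℕ.+ 1 ℕ.+ s) 1
  ... | U | lower , upper = ℕₚ.≤-antisym
    (undiffℕ (subst (λ i → NonNeg (i - + U)) (sym +[2t+1]) (upper-bound {+ s} {+ t} {+ U} lower′ s≤2t+2)))
    (undiffℕ (subst (λ i → NonNeg (+ U - i)) (sym +[2t+1]) (lower-bound {+ s} {+ t} {+ U} upper′ 2t<s)))
    where
    lower′ : NonNeg (+ 2 * + t + + 1 + + s - + U * + 2)
    lower′ = subst (λ i → NonNeg (i + + s - + U * + 2)) +[2t+1] lower
    upper′ : NonNeg (+ U * + 2 + + 2 - (+ 2 * + t + + 1 + + s) - + 1)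
    upper′ = subst (λ i → NonNeg (+ U * + 2 + + 2 - (i + + s) - + 1)) +[2t+1] upper
    upper-bound : ∀ {s t U} → NonNeg (+ 2 * t + + 1 + s - U * + 2) → NonNeg (+ 2 * t + + 2 - s) →
                  NonNeg (+ 2 * t + + 1 - U)
    upper-bound {s} {t} {U} h h' = from-contra (+ 2 * t + + 1 - U) λ lt →
      refute (h ⊞ h' ⊞ lt ⊞ lt) (solve (s ∷ t ∷ U ∷ []))
    lower-bound : ∀ {s t U} → NonNeg (U * + 2 + + 2 - (+ 2 * t + + 1 + s) - + 1) →
                  NonNeg (s - + 1 - + 2 * t) → NonNeg (U - (+ 2 * t + + 1))
    lower-bound {s} {t} {U} h h' = from-contra (U - (+ 2 * t + + 1)) λ lt →
      refute (h ⊞ h' ⊞ lt ⊞ lt) (solve (s ∷ t ∷ U ∷ []))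

-- The sequence of the α and the signs of its norms

αs-rec : ∀ D j → αs D (2 ℕ.+ j) ≡ u D (1 ℕ.+ j) · αs D (1 ℕ.+ j) ⊕ αs D j
αs-rec D j with is1mod4 D
... | true  = trans (cong₂ _-_ (cast p₁ p₀) (cast q₁ q₀)) (eq (+ n) (+ p₁) (+ p₀) (+ q₁) (+ q₀)) ≐ cast q₁ q₀
  where
  n = u D (1 ℕ.+ j)
  p₀ = proj₁ (pq D j)
  q₀ = proj₂ (pq D j)
  p₁ = proj₁ (pq D (1 ℕ.+ j))
  q₁ = proj₂ (pq D (1 ℕ.+ j))
  cast : ∀ i k → + (n ℕ.* i ℕ.+ k) ≡ + n * + i + + k
  cast i k = cong (_+ + k) (ℤₚ.pos-* n i)
  eq : ∀ n p₁ p₀ q₁ q₀ → n * p₁ + p₀ - (n * q₁ + q₀) ≡ n * (p₁ - q₁) + (p₀ - q₀)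
  eq = solve-∀
... | false = cong (_+ + proj₁ (pq D j)) (ℤₚ.pos-* (u D (1 ℕ.+ j)) _) ≐
              cong (_+ + proj₂ (pq D j)) (ℤₚ.pos-* (u D (1 ℕ.+ j)) _)

αs-zero : ∀ D → αs D 0 ≡ (+ 1) ω+ (+ 0)
αs-zero D with is1mod4 D
... | true  = refl
... | false = refl

conj-one : ∀ D → conj D ((+ 1) ω+ (+ 0)) ≡ (+ 1) ω+ (+ 0)
conj-one D with is1mod4 D
... | true  = refl
... | false = refl

trace-one : ∀ D → trace D ((+ 1) ω+ (+ 0)) ≡ + 2
trace-one D with is1mod4 D
... | true  = refl
... | false = refl

slope-one : ∀ D → slope D ((+ 1) ω+ (+ 0)) ≡ + 0
slope-one D with is1mod4 D
... | true  = refl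
... | false = refl

b-αs-one : ∀ D → b (αs D 1) ≡ + 1
b-αs-one D with is1mod4 D
... | true  = refl
... | false = refl

module Signs (D : ℕ) (2≤D : 2 ℕ.≤ D) (D-squareFree : SquareFree D) where
  open ContinuedFraction D 2≤D D-squareFree

  φ-αs-rec : ∀ {φ} → Linear φ → ∀ j →
             φ (αs D (2 ℕ.+ j)) ≡ + u D (1 ℕ.+ j) * φ (αs D (1 ℕ.+ j)) + φ (αs D j)
  φ-αs-rec {φ} φ-linear j = trans (cong φ (αs-rec D j))
    (trans (⊕-homo φ-linear (u D (1 ℕ.+ j) · αs D (1 ℕ.+ j)) (αs D j))
           (cong (_+ φ (αs D j)) (·-homo φ-linear (u D (1 ℕ.+ j)) (αs D (1 ℕ.+ j)))))

  private
    half : ∀ n → (n ℕ.+ n ℕ.+ 1) / 2 ≡ n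
    half n = trans (cong (_/ 2) (trans (ℕₚ.+-comm (n ℕ.+ n) 1) (cong suc (sym (trans (ℕₚ.*-comm n 2) (cong (n ℕ.+_) (ℕₚ.+-identityʳ n)))))))
      (trans (DivMod.+-distrib-/ 1 (n ℕ.* 2) (subst (λ i → 1 ℕ.+ i ℕ.< 2) (sym (DivMod.m*n%n≡0 n 2)) ℕₚ.≤-refl))
        (DivMod.m*n/n≡m n 2))

  p₀-else : is1mod4 D ≡ false → (u D 0 ℕ.+ 1) / 2 ≡ s
  p₀-else eq = trans (cong (λ n → (n ℕ.+ 1) / 2) (u₀-else eq)) (half s)

  p₀-1mod4 : is1mod4 D ≡ true → (u D 0 ℕ.+ 1) / 2 ≡ t ℕ.+ 1
  p₀-1mod4 eq = trans (cong (λ n → (n ℕ.+ 1) / 2) (u₀-1mod4 eq))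
    (trans (cong (_/ 2) (trans (ℕₚ.+-assoc (2 ℕ.* t) 1 1) (trans (cong₂ ℕ._+_ (ℕₚ.*-comm 2 t) refl) (sym (ℕₚ.*-distribʳ-+ 2 t 1)))))
           (DivMod.m*n/n≡m (t ℕ.+ 1) 2))

  α₁-else : is1mod4 D ≡ false → αs D 1 ≡ (+ s) ω+ (+ 1)
  α₁-else eq = trans (unfold eq) (cong (λ p → (+ p) ω+ (+ 1)) (p₀-else eq))
    where
    unfold : is1mod4 D ≡ false → αs D 1 ≡ (+ ((u D 0 ℕ.+ 1) / 2)) ω+ (+ 1)
    unfold eq rewrite eq = refl

  α₁-1mod4 : is1mod4 D ≡ true → αs D 1 ≡ (+ t) ω+ (+ 1)
  α₁-1mod4 eq = trans (unfold eq) (trans (cong (λ p → (+ p - + 1) ω+ (+ 1)) (p₀-1mod4 eq)) (cancel (+ t) ≐ refl))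
    where
    unfold : is1mod4 D ≡ true → αs D 1 ≡ (+ ((u D 0 ℕ.+ 1) / 2) - + 1) ω+ (+ 1)
    unfold eq rewrite eq = refl
    cancel : ∀ i → i + + 1 - + 1 ≡ i
    cancel = solve-∀

  -- Here the sequence meets its conjugate: the two neighbours of β 0 = 1 are conjugate to each
  -- other, and this trace produces c 0 = u₀ + 2.
  conj-α₁ : conj D (αs D 1) ⊕ αs D 1 ≡ u D 0 · αs D 0
  conj-α₁ with 1mod4?
  ... | inj₁ eq rewrite α₁-1mod4 eq | αs-zero D | u₀-1mod4 eq = unfold eq
    where
    sum : ∀ i → i + + 1 + i ≡ (+ 2 * i + + 1) * + 1
    sum = solve-∀
    unfold : is1mod4 D ≡ true → conj D ((+ t) ω+ (+ 1)) ⊕ ((+ t) ω+ (+ 1)) ≡ (2 ℕ.* t ℕ.+ 1) · ((+ 1) ω+ (+ 0))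
    unfold eq rewrite eq = trans (sum (+ t)) (cong (_* + 1) (sym +[2t+1])) ≐ sym (ℤₚ.*-zeroʳ (+ (2 ℕ.* t ℕ.+ 1)))
  ... | inj₂ eq rewrite α₁-else eq | αs-zero D | u₀-else eq = unfold eq
    where
    unfold : is1mod4 D ≡ false → conj D ((+ s) ω+ (+ 1)) ⊕ ((+ s) ω+ (+ 1)) ≡ (s ℕ.+ s) · ((+ 1) ω+ (+ 0))
    unfold eq rewrite eq = sym (ℤₚ.*-identityʳ (+ (s ℕ.+ s))) ≐ sym (ℤₚ.*-zeroʳ (+ (s ℕ.+ s)))

  trace-α₁ : trace D (αs D 1) ≡ + u D 0
  trace-α₁ = ℤₚ.*-cancelˡ-≡ (+ 2) _ _ (begin
    + 2 * trace D (αs D 1)                         ≡⟨ double (trace D (αs D 1)) ⟩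
    trace D (αs D 1) + trace D (αs D 1)            ≡⟨ cong (_+ trace D (αs D 1)) (trace-conj D (αs D 1)) ⟨
    trace D (conj D (αs D 1)) + trace D (αs D 1)   ≡⟨ ⊕-homo (trace-linear D) (conj D (αs D 1)) (αs D 1) ⟨
    trace D (conj D (αs D 1) ⊕ αs D 1)             ≡⟨ cong (trace D) conj-α₁ ⟩
    trace D (u D 0 · αs D 0)                       ≡⟨ ·-homo (trace-linear D) (u D 0) (αs D 0) ⟩
    + u D 0 * trace D (αs D 0)                     ≡⟨ cong (λ x → + u D 0 * trace D x) (αs-zero D) ⟩
    + u D 0 * trace D ((+ 1) ω+ (+ 0))                 ≡⟨ cong (+ u D 0 *_) (trace-one D) ⟩
    + u D 0 * + 2                                  ≡⟨ ℤₚ.*-comm (+ u D 0) (+ 2) ⟩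
    + 2 * + u D 0                                  ∎)
    where
    open ≡-Reasoning
    double : ∀ i → + 2 * i ≡ i + i
    double = solve-∀

  -- α_i = (√D - P_{i+2}) α_{i+1} / Q_{i+2} in the numbering of the paper, so norms alternate in sign.
  ProportionalAt : ℕ → Set
  ProportionalAt j = Proportional {+ D} (+ P (1 ℕ.+ j)) (+ Q (1 ℕ.+ j))
    (trace D (αs D j)) (slope D (αs D j)) (trace D (αs D (1 ℕ.+ j))) (slope D (αs D (1 ℕ.+ j)))

  private
    P-sum : ∀ i → + P (suc i) + + P i ≡ + u D i * + Q i
    P-sum i = trans (cong (_+ + P i) (Step.P-suc i (reduced i))) (cancel (+ u D i * + Q i) (+ P i))
      where cancel : ∀ i j → i - j + j ≡ i
            cancel = solve-∀

  -- Both residue classes satisfy `αs D 1` = (P₁ + √D) / Q₀. Together with `trace-α₁` the two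
  -- equations express this, and `proportional₀` follows from (√D - P₁)(√D + P₁) = Q₀ Q₁.
  slope-α₁ : + Q 0 * slope D (αs D 1) ≡ + 2 × slope D (αs D 1) * + P 1 ≡ + u D 0
  slope-α₁ with 1mod4?
  ... | inj₁ eq = cong₂ (λ i j → + i * j) (cong proj₂ (cfInit-1mod4 eq)) (slope-α eq) ,
    trans (cong₂ _*_ (slope-α eq) (Step.P-suc 0 (reduced 0)))
      (trans (cong (_*_ (+ 1)) (cong₃ (cong +_ (u₀-1mod4 eq)) (cong proj₂ (cfInit-1mod4 eq)) (cong proj₁ (cfInit-1mod4 eq))))
        (trans (cancel (+ (2 ℕ.* t ℕ.+ 1))) (cong +_ (sym (u₀-1mod4 eq)))))
    where
    slope-α : is1mod4 D ≡ true → slope D (αs D 1) ≡ + 1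
    slope-α eq rewrite eq = refl
    cancel : ∀ i → + 1 * (i * + 2 - i) ≡ i
    cancel = solve-∀
    cong₃ : ∀ {i i' m m' n n'} → i ≡ i' → m ≡ m' → n ≡ n' → i * + m - + n ≡ i' * + m' - + n'
    cong₃ refl refl refl = refl
  ... | inj₂ eq = cong₂ (λ i j → + i * j) (cong proj₂ (cfInit-else eq)) (slope-α eq) ,
    trans (cong₂ _*_ (slope-α eq) (Step.P-suc 0 (reduced 0)))
      (trans (cong (_*_ (+ 2)) (cong₃ (cong +_ (u₀-else eq)) (cong proj₂ (cfInit-else eq)) (cong proj₁ (cfInit-else eq))))
        (trans (cancel (+ s)) (cong +_ (sym (u₀-else eq)))))
    where
    slope-α : is1mod4 D ≡ false → slope D (αs D 1) ≡ + 2
    slope-α eq rewrite eq = refl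
    cancel : ∀ i → + 2 * ((i + i) * + 1 - i) ≡ i + i
    cancel = solve-∀
    cong₃ : ∀ {i i' m m' n n'} → i ≡ i' → m ≡ m' → n ≡ n' → i * + m - + n ≡ i' * + m' - + n'
    cong₃ refl refl refl = refl

  proportional₀ : ProportionalAt 0
  proportional₀ = from-init {Q₀ = + Q 0} (proj₁ slope-α₁) (trans trace-α₁ (sym (proj₂ slope-α₁)))
    (trans (cong (trace D) (αs-zero D)) (trace-one D)) (trans (cong (slope D) (αs-zero D)) (slope-one D))
    (Step.split 0 (reduced 0))
    where
    from-init : ∀ {d Q₀ P₁ Q₁ X₀ Y₀ X₁ Y₁} → Q₀ * Y₁ ≡ + 2 → X₁ ≡ Y₁ * P₁ → X₀ ≡ + 2 → Y₀ ≡ + 0 →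
                P₁ * P₁ + Q₀ * Q₁ ≡ d → Proportional {d} P₁ Q₁ X₀ Y₀ X₁ Y₁
    from-init {_} {Q₀} {P₁} {Q₁} {Y₁ = Y₁} eq refl refl refl refl = proportional
      (trans (cong (Q₁ *_) (sym eq)) (eq₁ Q₀ P₁ Q₁ Y₁)) (eq₂ P₁ Q₁ Y₁)
      where
      eq₁ : ∀ Q₀ P₁ Q₁ Y₁ → Q₁ * (Q₀ * Y₁) ≡ (P₁ * P₁ + Q₀ * Q₁) * Y₁ - P₁ * (Y₁ * P₁)
      eq₁ = solve-∀
      eq₂ : ∀ P₁ Q₁ Y₁ → Q₁ * + 0 ≡ Y₁ * P₁ - P₁ * Y₁
      eq₂ = solve-∀

  proportional-at : ∀ j → ProportionalAt j
  proportional-at zero = proportional₀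
  proportional-at (suc j) = proportional-step {U = + u D (suc j)} (Reduced.Q≥1 (reduced (suc j)))
    (P-sum (suc j)) (Step.split (suc j) (reduced (suc j)))
    (φ-αs-rec (trace-linear D) j) (φ-αs-rec (slope-linear D) j) (proportional-at j)

  private
    P²<D : ∀ i → NonNeg (+ D - + P i * + P i - + 1)
    P²<D i = bound {+ P i} {+ s} {+ D} (Reduced.P≤s (reduced i)) nat nat s²<D
      where
      bound : ∀ {P s d} → NonNeg (s - P) → NonNeg s → NonNeg P → NonNeg (d - s * s - + 1) → NonNeg (d - P * P - + 1)
      bound {P} {s} {d} P≤s s≥0 P≥0 s²<d = via (P≤s ⊠ (s≥0 ⊞ P≥0) ⊞ s²<d) (solve (P ∷ s ∷ d ∷ []))

    flip : ∀ j → NonNeg (norm D (αs D j) - + 1) → NonNeg (- norm D (αs D (1 ℕ.+ j)) - + 1)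
    flip j = norm-flip {+ D} {+ P (1 ℕ.+ j)} {+ Q (1 ℕ.+ j)} {norm D (αs D j)} {norm D (αs D (1 ℕ.+ j))}
      (Reduced.Q≥1 (reduced (1 ℕ.+ j))) (P²<D (1 ℕ.+ j)) (norms (proportional-at j))

    flip′ : ∀ j → NonNeg (- norm D (αs D j) - + 1) → NonNeg (norm D (αs D (1 ℕ.+ j)) - + 1)
    flip′ j lt = subst (λ i → NonNeg (i - + 1)) (ℤₚ.neg-involutive (norm D (αs D (1 ℕ.+ j))))
      (norm-flip {+ D} {+ P (1 ℕ.+ j)} {+ Q (1 ℕ.+ j)} { - norm D (αs D j)} { - norm D (αs D (1 ℕ.+ j))}
      (Reduced.Q≥1 (reduced (1 ℕ.+ j))) (P²<D (1 ℕ.+ j)) (negated (+ Q (1 ℕ.+ j) * + Q (1 ℕ.+ j)) (norm D (αs D j)) (+ D - + P (1 ℕ.+ j) * + P (1 ℕ.+ j))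
        (- norm D (αs D (1 ℕ.+ j))) (norms (proportional-at j))) lt)
      where
      negated : ∀ i j k l → i * j ≡ k * l → i * - j ≡ k * - l
      negated i j k l eq = trans (sym (ℤₚ.neg-distribʳ-* i j)) (trans (cong -_ eq) (ℤₚ.neg-distribʳ-* k l))

  -- Even positions of `αs` are the odd indices i of the families, because `αs` is shifted by one.
  -- The sequence starts at the element 1, and every step reverses the sign of the norm.
  even-norm : ∀ k → NonNeg (norm D (αs D (2 ℕ.* k)) - + 1)
  odd-norm : ∀ k → NonNeg (- norm D (αs D (1 ℕ.+ 2 ℕ.* k)) - + 1)
  odd-norm k = flip (2 ℕ.* k) (even-norm k)
  even-norm zero = subst (λ x → NonNeg (norm D x - + 1)) (sym (αs-zero D)) (subst₂ (λ i j → NonNeg (i * i - + D * (j * j) - + 1))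
    (sym (trace-one D)) (sym (slope-one D)) (via (nat {3}) (eq (+ D))))
    where eq : ∀ d → + 3 ≡ + 2 * + 2 - d * (+ 0 * + 0) - + 1
          eq = solve-∀
  even-norm (suc k) = subst (λ j → NonNeg (norm D (αs D j) - + 1)) (sym (ℕₚ.*-suc 2 k))
    (flip′ (1 ℕ.+ 2 ℕ.* k) (odd-norm k))

  trace-αs : ∀ j → NonNeg (trace D (αs D j) - + 1)
  trace-αs zero = subst (λ i → NonNeg (i - + 1)) (sym (trans (cong (trace D) (αs-zero D)) (trace-one D))) nat
  trace-αs (suc zero) = subst (λ i → NonNeg (i - + 1)) (sym trace-α₁) (diffℕ (1≤u 0))
  trace-αs (suc (suc j)) = subst (λ i → NonNeg (i - + 1))
    (sym (φ-αs-rec (trace-linear D) j))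
    (grows {+ u D (1 ℕ.+ j)} {trace D (αs D (1 ℕ.+ j))} {trace D (αs D j)} (nat {u D (1 ℕ.+ j)}) (trace-αs (suc j)) (trace-αs j))
    where
    grows : ∀ {n i j} → NonNeg n → NonNeg (i - + 1) → NonNeg (j - + 1) → NonNeg (n * i + j - + 1)
    grows {n} {i} {j} n≥0 i≥1 j≥1 = via (n≥0 ⊠ (i≥1 ⊞ nat {1}) ⊞ j≥1) (solve (n ∷ i ∷ j ∷ []))

  even-totPos : ∀ k → TotPos D (αs D (2 ℕ.* k))
  even-totPos k = Positive⇒TotPos D (positive (trace-αs (2 ℕ.* k)) (even-norm k))

-- The chain of the α_{i,r}

positive-divide : ∀ {d n X Y} → NonNeg (n - + 1) → Positive d (n * X) (n * Y) → Positive d X Y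
positive-divide {d} {n} {X} {Y} n≥1 (positive p q) = positive (*-cancel-pos {n} {X} n≥1 p)
  (*-cancel-pos {n} {N} n≥1 (*-cancel-pos {n} {n * N} n≥1 (via q (eq d n X Y))))
  where
  N = X * X - d * (Y * Y)
  eq : ∀ d n X Y → n * X * (n * X) - d * (n * Y * (n * Y)) - + 1 ≡ n * (n * (X * X - d * (Y * Y))) - + 1
  eq = solve-∀

TotPos-divide : ∀ D n {x} → 1 ℕ.≤ n → TotPos D (n · x) → TotPos D x
TotPos-divide D n {x} 1≤n p = Positive⇒TotPos D (positive-divide {n = + n} (diffℕ 1≤n)
  (subst₂ (Positive (+ D)) (·-homo (trace-linear D) n x) (·-homo (slope-linear D) n x) (TotPos⇒Positive D p)))

norm-multiple≤0 : ∀ {d n X Y} → NonNeg (- (X * X - d * (Y * Y)) - + 1) → ¬ Positive d (+ n * X) (+ n * Y)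
norm-multiple≤0 {d} {n} {X} {Y} N<0 (positive _ p) =
  refute (p ⊞ nat {n} ⊠ nat {n} ⊠ (N<0 ⊞ nat {1})) (eq d (+ n) X Y)
  where
  eq : ∀ d n X Y → n * X * (n * X) - d * (n * Y * (n * Y)) - + 1
         + n * n * (- (X * X - d * (Y * Y)) - + 1 + + 1) ≡ - + 1
  eq = solve-∀

bounded-swap : ∀ {p q e f} → Bounded p q e f → Bounded q p f e
bounded-swap {p} {q} {e} {f} (r , s , t) =
  s , r , subst₂ (λ i j → 3 ℕ.+ i ℕ.≤ j) (ℕₚ.+-comm e f) (ℕₚ.+-comm p q) t

bounded-intro : ∀ {m n e f} → e ℕ.≤ m ℕ.+ 1 → f ℕ.≤ n ℕ.+ 1 → e ℕ.+ f ℕ.≤ suc (m ℕ.+ n) →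
                Bounded (2 ℕ.+ m) (2 ℕ.+ n) e f
bounded-intro {m} {n} {e} {f} e≤m+1 f≤n+1 e+f≤ =
  s≤s (subst (e ℕ.≤_) (ℕₚ.+-comm m 1) e≤m+1) , s≤s (subst (f ℕ.≤_) (ℕₚ.+-comm n 1) f≤n+1) ,
  subst (3 ℕ.+ (e ℕ.+ f) ℕ.≤_) (cong (2 ℕ.+_) (sym (trans (ℕₚ.+-suc m (suc n)) (cong suc (ℕₚ.+-suc m n)))))
    (s≤s (s≤s (s≤s e+f≤)))

bounded-total : ∀ {m n e f} → Bounded (2 ℕ.+ m) (2 ℕ.+ n) e f → e ℕ.+ f ℕ.≤ suc (m ℕ.+ n)
bounded-total {m} {n} {e} {f} (_ , _ , t) = ℕₚ.+-cancelˡ-≤ 3 _ _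
  (subst (3 ℕ.+ (e ℕ.+ f) ℕ.≤_) (cong (2 ℕ.+_) (trans (ℕₚ.+-suc m (suc n)) (cong suc (ℕₚ.+-suc m n)))) t)

bounded-left : ∀ {m n e f} → Bounded (2 ℕ.+ m) n e f → e ℕ.≤ m ℕ.+ 1
bounded-left {m} {_} {e} (r , _) = subst (e ℕ.≤_) (ℕₚ.+-comm 1 m) (ℕₚ.≤-pred r)


-- Listed D is ListedBy (u D) (αs D) by computation; keeping υ and α abstract stops Agda from
-- unfolding the continued fraction algorithm.
ListedBy : (ℕ → ℕ) → (ℕ → OK) → OK → Set
ListedBy υ α x = ∃[ k ] let j = 2 ℕ.* k in
    (∃[ r ] (r ℕ.≤ υ (1 ℕ.+ j) ℕ.∸ 1 × x ≡ αᵣ j r))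
  ⊎ (∃[ e ] (2 ℕ.≤ e × e ℕ.≤ υ j ℕ.+ 1 × x ≡ e · αᵣ j 0))
  ⊎ (2 ℕ.≤ υ (1 ℕ.+ j) × ∃[ f ] (1 ℕ.≤ f × f ℕ.≤ υ (2 ℕ.+ j) ×
        x ≡ αᵣ j (υ (1 ℕ.+ j) ℕ.∸ 1) ⊕ f · αᵣ (2 ℕ.+ j) 0))
  ⊎ (2 ℕ.≤ υ (1 ℕ.+ j) × ∃[ e ] (1 ℕ.≤ e × e ℕ.≤ υ j × x ≡ e · αᵣ j 0 ⊕ αᵣ j 1))
  ⊎ (υ (1 ℕ.+ j) ≡ 1 × ∃[ e ] ∃[ f ] (1 ℕ.≤ e × e ℕ.≤ υ j ℕ.+ 1 ×
        1 ℕ.≤ f × f ℕ.≤ υ (2 ℕ.+ j) ℕ.+ 1 ×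
        ¬ (e ≡ υ j ℕ.+ 1 × f ≡ υ (2 ℕ.+ j) ℕ.+ 1) ×
        x ≡ e · αᵣ j 0 ⊕ f · αᵣ (2 ℕ.+ j) 0))
  where
  αᵣ : ℕ → ℕ → OK
  αᵣ j r = α j ⊕ r · α (suc j)

module Vertices (D : ℕ) (υ : ℕ → ℕ) (α : ℕ → OK)
  (1≤υ : ∀ i → 1 ℕ.≤ υ i)
  (α-rec : ∀ j → α (2 ℕ.+ j) ≡ υ (1 ℕ.+ j) · α (1 ℕ.+ j) ⊕ α j)
  (α-zero : α 0 ≡ (+ 1) ω+ (+ 0))
  (b-α-one : b (α 1) ≡ + 1)
  (conj-α-one : conj D (α 1) ⊕ α 1 ≡ υ 0 · α 0)
  (even-totPos : ∀ k → TotPos D (α (2 ℕ.* k)))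
  (odd-norm : ∀ k → NonNeg (- norm D (α (1 ℕ.+ 2 ℕ.* k)) - + 1))
  where

  -- `node (k , r)` is α_{i,r} with i = 2 k - 1, and `edge` is the step to the next node. It depends
  -- on k alone, since the nodes from α_{i,0} to α_{i+2,0} lie on a line.
  node : ℕ × ℕ → OK
  node (k , r) = α (2 ℕ.* k) ⊕ r · α (1 ℕ.+ 2 ℕ.* k)

  edge : ℕ × ℕ → OK
  edge (k , _) = α (1 ℕ.+ 2 ℕ.* k)

  -- The amount by which c exceeds 2. The edge is constant inside a segment and changes at a corner
  -- by υ times that corner, so this is the coefficient in the second difference of the nodes.
  excess-at : ℕ × ℕ → ℕ
  excess-at (k , zero)  = υ (2 ℕ.* k)
  excess-at (k , suc _) = 0

  Valid : ℕ × ℕ → Set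
  Valid (k , r) = r ℕ.< υ (1 ℕ.+ 2 ℕ.* k)

  next : ℕ × ℕ → ℕ × ℕ
  next (k , r) with suc r ℕ.<? υ (1 ℕ.+ 2 ℕ.* k)
  ... | yes _ = k , suc r
  ... | no _  = suc k , 0

  next-inner : ∀ {k r} → suc r ℕ.< υ (1 ℕ.+ 2 ℕ.* k) → next (k , r) ≡ (k , suc r)
  next-inner {k} {r} lt with suc r ℕ.<? υ (1 ℕ.+ 2 ℕ.* k)
  ... | yes _  = refl
  ... | no ¬lt = ⊥-elim (¬lt lt)

  next-last : ∀ {k r} → υ (1 ℕ.+ 2 ℕ.* k) ≡ suc r → next (k , r) ≡ (suc k , 0)
  next-last {k} {r} eq with suc r ℕ.<? υ (1 ℕ.+ 2 ℕ.* k)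
  ... | yes lt = ⊥-elim (ℕₚ.<⇒≢ lt (sym eq))
  ... | no _   = refl

  next-cases : ∀ {k r} → Valid (k , r) →
    suc r ℕ.< υ (1 ℕ.+ 2 ℕ.* k) ⊎ υ (1 ℕ.+ 2 ℕ.* k) ≡ suc r
  next-cases {k} {r} v = [ inj₁ , (λ eq → inj₂ (sym eq)) ]′ (ℕₚ.m≤n⇒m<n∨m≡n v)

  next-valid : ∀ s → Valid s → Valid (next s)
  next-valid (k , r) v = [ (λ lt → subst Valid (sym (next-inner {k} {r} lt)) lt) ,
                           (λ eq → subst Valid (sym (next-last {k} {r} eq)) (1≤υ _)) ]′ (next-cases {k} {r} v)

  double-suc : ∀ k → 2 ℕ.* suc k ≡ 2 ℕ.+ 2 ℕ.* k
  double-suc k = ℕₚ.*-suc 2 k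

  node-zero : ∀ k → node (k , 0) ≡ α (2 ℕ.* k)
  node-zero k = trans (cong (α (2 ℕ.* k) ⊕_) (0-· (α (1 ℕ.+ 2 ℕ.* k)))) (⊕-identityʳ (α (2 ℕ.* k)))

  node-suc : ∀ k r → node (k , suc r) ≡ node (k , r) ⊕ edge (k , r)
  node-suc k r = trans (cong (x ⊕_) (trans (suc-· r y) (⊕-comm y (r · y)))) (sym (⊕-assoc x (r · y) y))
    where
    x = α (2 ℕ.* k)
    y = α (1 ℕ.+ 2 ℕ.* k)

  node-last : ∀ k → node (k , υ (1 ℕ.+ 2 ℕ.* k)) ≡ node (suc k , 0)
  node-last k = trans (⊕-comm (α (2 ℕ.* k)) _)
    (trans (sym (trans (cong α (double-suc k)) (α-rec (2 ℕ.* k)))) (sym (node-zero (suc k))))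

  node-next : ∀ s → Valid s → node (next s) ≡ node s ⊕ edge s
  node-next (k , r) v = [ inner , last ]′ (next-cases {k} {r} v)
    where
    inner : suc r ℕ.< υ (1 ℕ.+ 2 ℕ.* k) → node (next (k , r)) ≡ node (k , r) ⊕ edge (k , r)
    inner lt = trans (cong node (next-inner {k} {r} lt)) (node-suc k r)
    last : υ (1 ℕ.+ 2 ℕ.* k) ≡ suc r → node (next (k , r)) ≡ node (k , r) ⊕ edge (k , r)
    last eq = trans (cong node (next-last {k} {r} eq))
      (trans (sym (node-last k)) (trans (cong (λ n → node (k , n)) eq) (node-suc k r)))

  edge-next : ∀ s → Valid s → edge (next s) ≡ edge s ⊕ excess-at (next s) · node (next s)
  edge-next (k , r) v = [ inner , last ]′ (next-cases {k} {r} v)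
    where
    Goal : ℕ × ℕ → Set
    Goal s = edge s ≡ edge (k , r) ⊕ excess-at s · node s
    inner : suc r ℕ.< υ (1 ℕ.+ 2 ℕ.* k) → Goal (next (k , r))
    inner lt = subst Goal (sym (next-inner {k} {r} lt))
      (sym (trans (cong (edge (k , r) ⊕_) (0-· (node (k , suc r)))) (⊕-identityʳ (edge (k , r)))))
    last : υ (1 ℕ.+ 2 ℕ.* k) ≡ suc r → Goal (next (k , r))
    last eq = subst Goal (sym (next-last {k} {r} eq)) (begin
      α (1 ℕ.+ 2 ℕ.* suc k)          ≡⟨ cong (λ j → α (1 ℕ.+ j)) (double-suc k) ⟩
      α (2 ℕ.+ (1 ℕ.+ 2 ℕ.* k))      ≡⟨ α-rec (1 ℕ.+ 2 ℕ.* k) ⟩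
      υ (2 ℕ.+ 2 ℕ.* k) · α (2 ℕ.+ 2 ℕ.* k) ⊕ α (1 ℕ.+ 2 ℕ.* k)
        ≡⟨ cong (λ j → υ j · α j ⊕ α (1 ℕ.+ 2 ℕ.* k)) (double-suc k) ⟨
      υ (2 ℕ.* suc k) · α (2 ℕ.* suc k) ⊕ α (1 ℕ.+ 2 ℕ.* k) ≡⟨ ⊕-comm (υ (2 ℕ.* suc k) · α (2 ℕ.* suc k)) _ ⟩
      α (1 ℕ.+ 2 ℕ.* k) ⊕ υ (2 ℕ.* suc k) · α (2 ℕ.* suc k)
        ≡⟨ cong (λ x → α (1 ℕ.+ 2 ℕ.* k) ⊕ υ (2 ℕ.* suc k) · x) (node-zero (suc k)) ⟨
      α (1 ℕ.+ 2 ℕ.* k) ⊕ υ (2 ℕ.* suc k) · node (suc k , 0) ∎)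
      where open ≡-Reasoning

  -- υ (x + r y) = (υ - r) x + r (υ y + x): a node is a convex combination of α_{2k} and α_{2k+2}.
  node-totPos : ∀ s → Valid s → TotPos D (node s)
  node-totPos (k , r) v = TotPos-divide D n (1≤υ (1 ℕ.+ 2 ℕ.* k)) (subst (TotPos D) (sym split)
    (TotPos-combination D (n ℕ.∸ r) r (even-totPos k) (subst (λ j → TotPos D (α j)) (double-suc k) (even-totPos (suc k)))
      (ℕₚ.≤-trans (ℕₚ.m<n⇒0<n∸m v) (ℕₚ.m≤m+n (n ℕ.∸ r) r))))
    where
    n = υ (1 ℕ.+ 2 ℕ.* k)
    x = α (2 ℕ.* k)
    y = α (1 ℕ.+ 2 ℕ.* k)
    eq : ∀ n r x y → n * (x + r * y) ≡ (n - r) * x + r * (n * y + x)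
    eq = solve-∀
    coordinate : ∀ i j → + n * (i + + r * j) ≡ + (n ℕ.∸ r) * i + + r * (+ n * j + i)
    coordinate i j = trans (eq (+ n) (+ r) i j)
      (cong (λ m → m * i + + r * (+ n * j + i)) (sym (+-∸ {n} {r} (ℕₚ.<⇒≤ v))))
    split : n · node (k , r) ≡ (n ℕ.∸ r) · x ⊕ r · α (2 ℕ.+ 2 ℕ.* k)
    split = trans (coordinate (a x) (a y) ≐ coordinate (b x) (b y))
      (cong (λ z → (n ℕ.∸ r) · x ⊕ r · z) (sym (α-rec (2 ℕ.* k))))

  vertex : ℕ → ℕ × ℕ
  vertex zero    = 0 , 0
  vertex (suc n) = next (vertex n)

  valid : ∀ n → Valid (vertex n)
  valid zero    = 1≤υ 1
  valid (suc n) = next-valid (vertex n) (valid n)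

  βₙ δₙ : ℕ → OK
  βₙ n = node (vertex n)
  δₙ n = edge (vertex n)

  cₙ : ℕ → ℕ
  cₙ n = 2 ℕ.+ excess-at (vertex n)

  βₙ-suc : ∀ n → βₙ (suc n) ≡ βₙ n ⊕ δₙ n
  βₙ-suc n = node-next (vertex n) (valid n)

  δₙ-suc : ∀ n → δₙ (suc n) ≡ δₙ n ⊕ excess-at (vertex (suc n)) · βₙ (suc n)
  δₙ-suc n = edge-next (vertex n) (valid n)

  βₙ-zero : βₙ 0 ≡ (+ 1) ω+ (+ 0)
  βₙ-zero = trans (node-zero 0) α-zero

  private
    second-difference : ∀ n x d → x ⊕ ((x ⊕ d) ⊕ (d ⊕ n · (x ⊕ d))) ≡ (2 ℕ.+ n) · (x ⊕ d)
    second-difference n x d = eq (+ n) (a x) (a d) ≐ eq (+ n) (b x) (b d)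
      where eq : ∀ n x d → x + ((x + d) + (d + n * (x + d))) ≡ (+ 2 + n) * (x + d)
            eq = solve-∀

  βₙ-neighbours : ∀ n → βₙ n ⊕ βₙ (2 ℕ.+ n) ≡ cₙ (1 ℕ.+ n) · βₙ (1 ℕ.+ n)
  βₙ-neighbours n = begin
    βₙ n ⊕ βₙ (2 ℕ.+ n)                           ≡⟨ cong (βₙ n ⊕_) (βₙ-suc (1 ℕ.+ n)) ⟩
    βₙ n ⊕ (βₙ (1 ℕ.+ n) ⊕ δₙ (1 ℕ.+ n))          ≡⟨ cong (λ z → βₙ n ⊕ (βₙ (1 ℕ.+ n) ⊕ z)) (δₙ-suc n) ⟩
    βₙ n ⊕ (βₙ (1 ℕ.+ n) ⊕ (δₙ n ⊕ m · βₙ (1 ℕ.+ n))) ≡⟨ cong (λ z → βₙ n ⊕ (z ⊕ (δₙ n ⊕ m · z))) (βₙ-suc n) ⟩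
    βₙ n ⊕ ((βₙ n ⊕ δₙ n) ⊕ (δₙ n ⊕ m · (βₙ n ⊕ δₙ n))) ≡⟨ second-difference m (βₙ n) (δₙ n) ⟩
    (2 ℕ.+ m) · (βₙ n ⊕ δₙ n)                     ≡⟨ cong ((2 ℕ.+ m) ·_) (βₙ-suc n) ⟨
    cₙ (1 ℕ.+ n) · βₙ (1 ℕ.+ n)                   ∎
    where
    open ≡-Reasoning
    m = excess-at (vertex (1 ℕ.+ n))

  conj-βₙ-zero : conj D (βₙ 0) ≡ βₙ 0
  conj-βₙ-zero = trans (cong (conj D) βₙ-zero) (trans (conj-one D) (sym βₙ-zero))

  conj-neighbours : conj D (βₙ 1) ⊕ βₙ 1 ≡ cₙ 0 · βₙ 0
  conj-neighbours = begin
    conj D (βₙ 1) ⊕ βₙ 1            ≡⟨ cong (λ x → conj D x ⊕ x) (βₙ-suc 0) ⟩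
    conj D (x ⊕ d) ⊕ (x ⊕ d)        ≡⟨ cong (_⊕ (x ⊕ d)) (conj-⊕ D x d) ⟩
    (conj D x ⊕ conj D d) ⊕ (x ⊕ d) ≡⟨ cong (λ y → (y ⊕ conj D d) ⊕ (x ⊕ d)) conj-βₙ-zero ⟩
    (x ⊕ conj D d) ⊕ (x ⊕ d)        ≡⟨ interchange x (conj D d) d ⟩
    (x ⊕ x) ⊕ (conj D d ⊕ d)        ≡⟨ cong ((x ⊕ x) ⊕_) (trans conj-α-one (cong (υ 0 ·_) (sym (node-zero 0)))) ⟩
    (x ⊕ x) ⊕ υ 0 · x               ≡⟨ collect (υ 0) x ⟩
    cₙ 0 · βₙ 0                     ∎
    where
    open ≡-Reasoning
    x = βₙ 0
    d = δₙ 0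
    interchange : ∀ x y z → (x ⊕ y) ⊕ (x ⊕ z) ≡ (x ⊕ x) ⊕ (y ⊕ z)
    interchange x y z = eq (a x) (a y) (a z) ≐ eq (b x) (b y) (b z)
      where eq : ∀ x y z → (x + y) + (x + z) ≡ (x + x) + (y + z)
            eq = solve-∀
    collect : ∀ n x → (x ⊕ x) ⊕ n · x ≡ (2 ℕ.+ n) · x
    collect n x = eq (+ n) (a x) ≐ eq (+ n) (b x)
      where eq : ∀ n x → (x + x) + n * x ≡ (+ 2 + n) * x
            eq = solve-∀

  b-βₙ-one : b (βₙ 1) ≡ + 1
  b-βₙ-one = trans (cong b (βₙ-suc 0)) (trans (cong (λ x → b x + b (α 1)) βₙ-zero) (trans (ℤₚ.+-identityˡ _) b-α-one))

  βₙ-totPos : ∀ n → TotPos D (βₙ n)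
  βₙ-totPos n = node-totPos (vertex n) (valid n)

  -- Descent to a basis with nonnegative coefficients

  -- During the descent the first coefficient may be negative, which `_·_` cannot express; hence the
  -- coordinatewise form.
  record Combination (x : OK) (n : ℕ) (e : ℤ) (f : ℕ) : Set where
    constructor combined
    field
      on-a : a x ≡ e * a (βₙ n) + + f * a (βₙ (suc n))
      on-b : b x ≡ e * b (βₙ n) + + f * b (βₙ (suc n))

  -- Otherwise x + (1 + m - f)β_n = f δ_n would be totally positive, although δ_n has negative norm.
  negative-coefficient : ∀ {x n m f} → TotPos D x → Combination x n -[1+ m ] f → suc m ℕ.< f
  negative-coefficient {x} {n} {m} {f} x>0 (combined on-a on-b) = ℕₚ.≰⇒> λ f≤m+1 →
    norm-multiple≤0 {n = f} (odd-norm (proj₁ (vertex n)))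
      (subst₂ (Positive (+ D)) (·-homo (trace-linear D) f (δₙ n)) (·-homo (slope-linear D) f (δₙ n))
        (TotPos⇒Positive D (subst (TotPos D) (sum f≤m+1)
          (TotPos-combination D 1 (suc m ℕ.∸ f) x>0 (βₙ-totPos n) (s≤s z≤n)))))
    where
    eq : ∀ m f β δ → + 1 * (- (+ 1 + m) * β + f * (β + δ)) + (+ 1 + m - f) * β ≡ f * δ
    eq = solve-∀
    coordinate : ∀ {i β δ β′} → f ℕ.≤ suc m → β′ ≡ β + δ → i ≡ -[1+ m ] * β + + f * β′ →
                 + 1 * i + + (suc m ℕ.∸ f) * β ≡ + f * δ
    coordinate {_} {β} {δ} f≤m+1 refl refl =
      trans (cong (λ k → + 1 * (-[1+ m ] * β + + f * (β + δ)) + k * β) (+-∸ {suc m} {f} f≤m+1))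
            (eq (+ m) (+ f) β δ)
    sum : f ℕ.≤ suc m → 1 · x ⊕ (suc m ℕ.∸ f) · βₙ n ≡ f · δₙ n
    sum f≤m+1 = coordinate {a x} {a (βₙ n)} {a (δₙ n)} {a (βₙ (suc n))} f≤m+1 (cong a (βₙ-suc n)) on-a ≐
                coordinate {b x} {b (βₙ n)} {b (δₙ n)} {b (βₙ (suc n))} f≤m+1 (cong b (βₙ-suc n)) on-b

  -- Substituting β_n = c β_{n+1} - β_{n+2} turns the coefficient -(m + 1) of β_n into the
  -- coefficient m + 1 of β_{n+2}.
  advance : ∀ {x n m f} → Combination x n -[1+ m ] f →
            Combination x (suc n) (+ f - + suc m * + cₙ (suc n)) (suc m)
  advance {x} {n} {m} {f} (combined on-a on-b) = combined
    (coordinate {a x} {a (βₙ n)} {a (βₙ (suc n))} {a (βₙ (2 ℕ.+ n))} (cong a (βₙ-neighbours n)) on-a)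
    (coordinate {b x} {b (βₙ n)} {b (βₙ (suc n))} {b (βₙ (2 ℕ.+ n))} (cong b (βₙ-neighbours n)) on-b)
    where
    coordinate : ∀ {i β β′ β″} → β + β″ ≡ + cₙ (suc n) * β′ → i ≡ -[1+ m ] * β + + f * β′ →
                 i ≡ (+ f - + suc m * + cₙ (suc n)) * β′ + + suc m * β″
    coordinate {_} {β} {β′} {β″} eq refl = begin
      -[1+ m ] * β + + f * β′                               ≡⟨ expand (+ m) (+ f) β β′ β″ ⟩
      + f * β′ - + suc m * (β + β″) + + suc m * β″          ≡⟨ cong (λ k → + f * β′ - + suc m * k + + suc m * β″) eq ⟩
      + f * β′ - + suc m * (+ cₙ (suc n) * β′) + + suc m * β″ ≡⟨ collect (+ m) (+ f) (+ cₙ (suc n)) β′ β″ ⟩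
      (+ f - + suc m * + cₙ (suc n)) * β′ + + suc m * β″    ∎
      where
      open ≡-Reasoning
      expand : ∀ m f β β′ β″ → - (+ 1 + m) * β + f * β′ ≡ f * β′ - (+ 1 + m) * (β + β″) + (+ 1 + m) * β″
      expand = solve-∀
      collect : ∀ m f c β′ β″ → f * β′ - (+ 1 + m) * (c * β′) + (+ 1 + m) * β″ ≡
                (f - (+ 1 + m) * c) * β′ + (+ 1 + m) * β″
      collect = solve-∀

  Spanned : OK → Set
  Spanned x = ∃[ n ] ∃[ e ] ∃[ f ] x ≡ e · βₙ n ⊕ f · βₙ (suc n)

  -- N bounds the second coefficient. By `negative-coefficient`, `advance` replaces f by m + 1 < f.
  descend : ∀ N {x n f} e → f ℕ.≤ N → TotPos D x → Combination x n e f → Spanned x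
  descend _ {n = n} {f} (+ e) _ _ (combined on-a on-b) = n , e , f , (on-a ≐ on-b)
  descend zero -[1+ m ] f≤0 x>0 comb =
    ⊥-elim (ℕₚ.n≮0 (ℕₚ.≤-trans (negative-coefficient x>0 comb) f≤0))
  descend (suc N) {f = f} -[1+ m ] f≤N x>0 comb = descend N _
    (ℕₚ.≤-pred (ℕₚ.≤-trans (negative-coefficient x>0 comb) f≤N)) x>0 (advance comb)

  start : ∀ {x f} → b x ≡ + f → Combination x 0 (a x - + f * a (βₙ 1)) f
  start {x} {f} b≡f = combined
    (trans (eq (a x) (+ f * a (βₙ 1))) (cong (λ k → (a x - + f * a (βₙ 1)) * k + + f * a (βₙ 1)) (sym (cong a βₙ-zero))))
    (trans b≡f (trans (eq′ (a x - + f * a (βₙ 1)) (+ f))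
      (cong₂ (λ i j → (a x - + f * a (βₙ 1)) * i + + f * j) (sym (cong b βₙ-zero)) (sym b-βₙ-one))))
    where
    eq : ∀ i j → i ≡ (i - j) * + 1 + j
    eq = solve-∀
    eq′ : ∀ i f → f ≡ i * + 0 + f * + 1
    eq′ = solve-∀

  b-conj : ∀ x → b (conj D x) ≡ - b x
  b-conj x with is1mod4 D
  ... | true  = refl
  ... | false = refl

  -- The coefficient of ω changes sign under conjugation, so x or its conjugate can start the
  -- descent with a natural second coefficient.
  spanned : ∀ {x} → TotPos D x → Spanned x ⊎ Spanned (conj D x)
  spanned {x} x>0 = by-sign (b x) refl
    where
    by-sign : ∀ i → b x ≡ i → Spanned x ⊎ Spanned (conj D x)
    by-sign (+ f) eq = inj₁ (descend f _ ℕₚ.≤-refl x>0 (start eq))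
    by-sign -[1+ f ] eq = inj₂ (descend (suc f) _ ℕₚ.≤-refl (TotPos-conj D x>0)
      (start {conj D x} (trans (b-conj x) (cong -_ eq))))

  -- The two-sided chain

  -- Conjugation fixes β 0 = 1, so the conjugates in reverse order continue the sequence to the
  -- left.
  β : ℤ → OK
  β (+ n)    = βₙ n
  β -[1+ n ] = conj D (βₙ (suc n))

  c : ℤ → ℕ
  c m = cₙ ℤ.∣ m ∣

  β-suc-neg : ∀ n → β (ℤ.suc -[1+ n ]) ≡ conj D (βₙ n)
  β-suc-neg zero    = sym conj-βₙ-zero
  β-suc-neg (suc n) = refl

  c-suc-neg : ∀ n → c (ℤ.suc -[1+ n ]) ≡ cₙ n
  c-suc-neg zero    = refl
  c-suc-neg (suc n) = refl

  β-neighbours : ∀ m → β (ℤ.pred m) ⊕ β (ℤ.suc m) ≡ c m · β m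
  β-neighbours (+ zero)  = conj-neighbours
  β-neighbours (+ suc n) = βₙ-neighbours n
  β-neighbours -[1+ n ]  = begin
    conj D (βₙ (2 ℕ.+ n)) ⊕ β (ℤ.suc -[1+ n ]) ≡⟨ cong (conj D (βₙ (2 ℕ.+ n)) ⊕_) (β-suc-neg n) ⟩
    conj D (βₙ (2 ℕ.+ n)) ⊕ conj D (βₙ n)      ≡⟨ ⊕-comm (conj D (βₙ (2 ℕ.+ n))) (conj D (βₙ n)) ⟩
    conj D (βₙ n) ⊕ conj D (βₙ (2 ℕ.+ n))      ≡⟨ conj-⊕ D (βₙ n) (βₙ (2 ℕ.+ n)) ⟨
    conj D (βₙ n ⊕ βₙ (2 ℕ.+ n))               ≡⟨ cong (conj D) (βₙ-neighbours n) ⟩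
    conj D (cₙ (suc n) · βₙ (suc n))           ≡⟨ conj-· D (cₙ (suc n)) (βₙ (suc n)) ⟩
    cₙ (suc n) · conj D (βₙ (suc n))           ∎
    where open ≡-Reasoning

  det-zero : det (βₙ 0) (βₙ 1) ≡ + 1
  det-zero = trans (cong (λ x → a x * b (βₙ 1) - b x * a (βₙ 1)) βₙ-zero)
    (trans (cong (λ i → + 1 * i - + 0 * a (βₙ 1)) b-βₙ-one) (eq (a (βₙ 1))))
    where eq : ∀ i → + 1 * + 1 - + 0 * i ≡ + 1
          eq = solve-∀

  β-unimodular : ∀ m → det (β m) (β (ℤ.suc m)) ≡ + 1
  β-unimodular (+ zero)       = det-zero
  β-unimodular (+ suc n)      = trans (sym (det-neighbours (cₙ (suc n)) (βₙ n) _ _ (βₙ-neighbours n))) (β-unimodular (+ n))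
  β-unimodular -[1+ zero ]    = trans (det-neighbours (cₙ 0) (β -[1+ 0 ]) _ _ (β-neighbours (+ 0))) det-zero
  β-unimodular -[1+ suc n ]   = trans (det-neighbours (cₙ (suc n)) (β -[1+ suc n ]) (β -[1+ n ]) _ (β-neighbours -[1+ n ]))
                                      (β-unimodular -[1+ n ])

  β-totPos : ∀ m → TotPos D (β m)
  β-totPos (+ n)    = βₙ-totPos n
  β-totPos -[1+ n ] = TotPos-conj D (βₙ-totPos (suc n))

  conj-combination-β : ∀ n e f → conj D (e · βₙ n ⊕ f · βₙ (suc n)) ≡ f · β -[1+ n ] ⊕ e · β (ℤ.suc -[1+ n ])
  conj-combination-β n e f = trans (conj-combination D e (βₙ n) f (βₙ (suc n)))
    (trans (⊕-comm (e · conj D (βₙ n)) _) (cong (λ x → f · conj D (βₙ (suc n)) ⊕ e · x) (sym (β-suc-neg n))))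

  β-span : ∀ {x} → TotPos D x → ∃[ m ] ∃[ e ] ∃[ f ] x ≡ e · β m ⊕ f · β (ℤ.suc m)
  β-span {x} x>0 with spanned x>0
  ... | inj₁ (n , e , f , eq) = + n , e , f , eq
  ... | inj₂ (n , e , f , eq) = -[1+ n ] , f , e ,
    trans (sym (conj-involutive D x)) (trans (cong (conj D) eq) (conj-combination-β n e f))

  chain : Chain D
  chain = record
    { β = β ; c = c ; 2≤c = λ m → s≤s (s≤s z≤n) ; neighbours = β-neighbours
    ; unimodular = β-unimodular ; β-totPos = β-totPos ; span = β-span }

  -- Bounded combinations and the families (a) to (e)

  record Represented (x : OK) : Set where
    constructor represented
    field
      n e f   : ℕ
      1≤e+f   : 1 ℕ.≤ e ℕ.+ f
      bounded : Bounded (cₙ n) (cₙ (suc n)) e f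
      sum     : x ≡ e · βₙ n ⊕ f · βₙ (suc n)

  UD⇔represented : ∀ x → UniquelyDecomposable D x ⇔ (Represented x ⊎ (∃[ y ] (Represented y × x ≡ conj D y)))
  UD⇔represented x = mk⇔ (λ ud → to (Equivalence.to (UD⇔bounded chain x) ud))
                         (λ r → Equivalence.from (UD⇔bounded chain x) (from r))
    where
    BoundedAt : Set
    BoundedAt = ∃[ m ] ∃[ e ] ∃[ f ] (1 ℕ.≤ e ℕ.+ f × Bounded (c m) (c (ℤ.suc m)) e f
                                      × x ≡ e · β m ⊕ f · β (ℤ.suc m))
    to : BoundedAt → Represented x ⊎ (∃[ y ] (Represented y × x ≡ conj D y))
    to (+ n , e , f , 1≤e+f , bounded , eq) = inj₁ (represented n e f 1≤e+f bounded eq)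
    to (-[1+ n ] , e , f , 1≤e+f , bounded , eq) = inj₂ (f · βₙ n ⊕ e · βₙ (suc n) ,
      represented n f e (subst (1 ℕ.≤_) (ℕₚ.+-comm e f) 1≤e+f)
        (subst (λ p → Bounded p (cₙ (suc n)) f e) (c-suc-neg n) (bounded-swap {cₙ (suc n)} {_} {e} {f} bounded)) refl ,
      trans eq (sym (conj-combination-β n f e)))
    from : Represented x ⊎ (∃[ y ] (Represented y × x ≡ conj D y)) → BoundedAt
    from (inj₁ (represented n e f 1≤e+f bounded eq)) = + n , e , f , 1≤e+f , bounded , eq
    from (inj₂ (y , represented n e f 1≤e+f bounded eq , eq′)) = -[1+ n ] , f , e ,
      subst (1 ℕ.≤_) (ℕₚ.+-comm e f) 1≤e+f ,
      subst (λ p → Bounded (cₙ (suc n)) p f e) (sym (c-suc-neg n)) (bounded-swap {_} {cₙ (suc n)} {e} {f} bounded) ,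
      trans eq′ (trans (cong (conj D) eq) (conj-combination-β n e f))

  node′ : ℕ → ℕ → OK
  node′ j r = α j ⊕ r · α (suc j)

  private
    plus-zero : ∀ x y → x ⊕ 0 · y ≡ x
    plus-zero x y = trans (cong (x ⊕_) (0-· y)) (⊕-identityʳ x)

  node-next-even : ∀ k → node (suc k , 0) ≡ node′ (2 ℕ.+ 2 ℕ.* k) 0
  node-next-even k = cong (λ j → node′ j 0) (double-suc k)

  -- At a corner, e = 1 belongs to (a) and larger e to (b). At any other node c is 2, so only e = 1
  -- remains, again in (a).
  single-listed : ∀ {x} k r e → Valid (k , r) → 1 ℕ.≤ e → e ℕ.< 2 ℕ.+ excess-at (k , r) →
                  x ≡ e · node (k , r) → ListedBy υ α x
  single-listed k zero 1 _ _ _ eq = k , inj₁ (0 , z≤n , trans eq (1-· _))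
  single-listed k zero (suc (suc e)) _ _ lt eq =
    k , inj₂ (inj₁ (suc (suc e) , s≤s (s≤s z≤n) ,
      subst (suc (suc e) ℕ.≤_) (ℕₚ.+-comm 1 (υ (2 ℕ.* k))) (ℕₚ.≤-pred lt) , eq))
  single-listed k (suc r) 1 v _ _ eq = k , inj₁ (suc r , ℕₚ.<⇒≤pred v , trans eq (1-· _))
  single-listed k (suc r) (suc (suc e)) _ _ (s≤s (s≤s ())) _

  -- The family is determined by which ends of the pair are corners: the left one only is (d), the
  -- right one only is (c), both is (e). With no corner there is no bounded pair.
  pair-listed : ∀ {x} k r e f → Valid (k , r) →
    Bounded (2 ℕ.+ excess-at (k , r)) (2 ℕ.+ excess-at (next (k , r))) (suc e) (suc f) →
    x ≡ suc e · node (k , r) ⊕ suc f · node (next (k , r)) → ListedBy υ α x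
  pair-listed {x} k r e f v = [ inner , last ]′ (next-cases {k} {r} v)
    where
    Goal : ℕ × ℕ → Set
    Goal s = Bounded (2 ℕ.+ excess-at (k , r)) (2 ℕ.+ excess-at s) (suc e) (suc f) →
             x ≡ suc e · node (k , r) ⊕ suc f · node s → ListedBy υ α x

    inner-goal : ∀ r f → suc r ℕ.< υ (1 ℕ.+ 2 ℕ.* k) →
      Bounded (2 ℕ.+ excess-at (k , r)) 2 (suc e) (suc f) →
      x ≡ suc e · node (k , r) ⊕ suc f · node (k , suc r) → ListedBy υ α x
    inner-goal zero zero 2≤u bounded eq = k , inj₂ (inj₂ (inj₂ (inj₁ (2≤u , suc e , s≤s z≤n ,
      subst (suc e ℕ.≤_) (ℕₚ.+-identityʳ (υ (2 ℕ.* k)))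
        (ℕₚ.≤-pred (subst (ℕ._≤ suc (υ (2 ℕ.* k) ℕ.+ 0)) (ℕₚ.+-comm (suc e) 1)
          (bounded-total {υ (2 ℕ.* k)} {0} {suc e} {1} bounded))) ,
      trans eq (cong (suc e · node (k , 0) ⊕_) (1-· (node (k , 1))))))))
    -- Both nodes have c = 2, so already e = f = 1 is the excluded corner of the bounds.
    inner-goal (suc r) zero _ bounded _ with subst (ℕ._≤ 1) (ℕₚ.+-comm (suc e) 1) (bounded-total {0} {0} {suc e} {1} bounded)
    ... | s≤s ()
    inner-goal _ (suc f) _ (_ , s≤s (s≤s ()) , _) _

    last-goal : ∀ r e → υ (1 ℕ.+ 2 ℕ.* k) ≡ suc r →
      Bounded (2 ℕ.+ excess-at (k , r)) (2 ℕ.+ υ (2 ℕ.+ 2 ℕ.* k)) (suc e) (suc f) →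
      x ≡ suc e · node (k , r) ⊕ suc f · node′ (2 ℕ.+ 2 ℕ.* k) 0 → ListedBy υ α x
    last-goal zero e u≡1 bounded eq = k , inj₂ (inj₂ (inj₂ (inj₂ (u≡1 , suc e , suc f , s≤s z≤n ,
      bounded-left {m} {2 ℕ.+ n} {suc e} {suc f} bounded , s≤s z≤n ,
      bounded-left {n} {2 ℕ.+ m} {suc f} {suc e} (bounded-swap {2 ℕ.+ m} {2 ℕ.+ n} {suc e} {suc f} bounded) ,
      not-both , eq))))
      where
      m = υ (2 ℕ.* k)
      n = υ (2 ℕ.+ 2 ℕ.* k)
      not-both : ¬ (suc e ≡ m ℕ.+ 1 × suc f ≡ n ℕ.+ 1)
      not-both (e≡ , f≡) = ℕₚ.1+n≰n (subst (ℕ._≤ suc (m ℕ.+ n))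
        (trans (cong₂ ℕ._+_ (trans e≡ (ℕₚ.+-comm m 1)) (trans f≡ (ℕₚ.+-comm n 1))) (cong suc (ℕₚ.+-suc m n)))
        (bounded-total {m} {n} {suc e} {suc f} bounded))
    last-goal (suc r) zero u≡r+2 bounded eq = k , inj₂ (inj₂ (inj₁ (
      subst (2 ℕ.≤_) (sym u≡r+2) (s≤s (s≤s z≤n)) , suc f , s≤s z≤n ,
      ℕₚ.≤-pred (bounded-total {0} {υ (2 ℕ.+ 2 ℕ.* k)} {1} {suc f} bounded) ,
      trans eq (cong (_⊕ suc f · node′ (2 ℕ.+ 2 ℕ.* k) 0)
        (trans (1-· (node (k , suc r))) (cong (λ n → node (k , n ℕ.∸ 1)) (sym u≡r+2)))))))
    last-goal (suc r) (suc e) _ (s≤s (s≤s ()) , _) _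

    inner : suc r ℕ.< υ (1 ℕ.+ 2 ℕ.* k) → Goal (next (k , r))
    inner lt = subst Goal (sym (next-inner {k} {r} lt)) (inner-goal r f lt)

    last : υ (1 ℕ.+ 2 ℕ.* k) ≡ suc r → Goal (next (k , r))
    last u≡ = subst Goal (sym (next-last {k} {r} u≡)) λ bounded eq → last-goal r e u≡
      (subst (λ j → Bounded (2 ℕ.+ excess-at (k , r)) (2 ℕ.+ υ j) (suc e) (suc f)) (double-suc k) bounded)
      (trans eq (cong (λ y → suc e · node (k , r) ⊕ suc f · y) (node-next-even k)))

  represented⇒listed : ∀ {x} → Represented x → ListedBy υ α x
  represented⇒listed (represented n zero zero () _ _)
  represented⇒listed (represented n zero (suc f) _ (_ , f<c , _) eq) =
    single-listed (proj₁ (vertex (suc n))) (proj₂ (vertex (suc n))) (suc f) (valid (suc n)) (s≤s z≤n) f<c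
      (trans eq (trans (cong (_⊕ suc f · βₙ (suc n)) (0-· (βₙ n))) (⊕-identityˡ _)))
  represented⇒listed (represented n (suc e) zero _ (e<c , _) eq) =
    single-listed (proj₁ (vertex n)) (proj₂ (vertex n)) (suc e) (valid n) (s≤s z≤n) e<c
      (trans eq (plus-zero _ (βₙ (suc n))))
  represented⇒listed (represented n (suc e) (suc f) _ bounded eq) =
    pair-listed (proj₁ (vertex n)) (proj₂ (vertex n)) e f (valid n) bounded eq

  -- Backwards along `next`: the predecessor of (k + 1 , 0) is the last node of the previous
  -- segment, at r = υ - 1.
  reach : ∀ k r → Valid (k , r) → ∃[ n ] vertex n ≡ (k , r)
  reach zero zero v = 0 , refl
  reach (suc k) zero v with reach k (υ (1 ℕ.+ 2 ℕ.* k) ℕ.∸ 1) (ℕₚ.≤-reflexive (ℕₚ.m+[n∸m]≡n (1≤υ _)))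
  ... | n , eq = suc n , trans (cong next eq) (next-last {k} (sym (ℕₚ.m+[n∸m]≡n (1≤υ _))))
  reach k (suc r) v with reach k r (ℕₚ.<⇒≤ v)
  ... | n , eq = suc n , trans (cong next eq) (next-inner {k} {r} v)

  -- The successor s is a separate argument, so that a family can fix it by `next-inner` or
  -- `next-last`, or leave `next` unevaluated when f = 0.
  represent : ∀ {x} k r e f → Valid (k , r) → 1 ℕ.≤ e ℕ.+ f → ∀ {s} → next (k , r) ≡ s →
    Bounded (2 ℕ.+ excess-at (k , r)) (2 ℕ.+ excess-at s) e f →
    x ≡ e · node (k , r) ⊕ f · node s → Represented x
  represent {x} k r e f v 1≤e+f refl bounded eq with reach k r v
  ... | n , at-n = represented n e f 1≤e+f
    (subst (λ s → Bounded (2 ℕ.+ excess-at s) (2 ℕ.+ excess-at (next s)) e f) (sym at-n) bounded)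
    (subst (λ s → x ≡ e · node s ⊕ f · node (next s)) (sym at-n) eq)

  listed⇒represented : ∀ {x} → ListedBy υ α x → Represented x
  listed⇒represented {x} (k , inj₁ (r , r≤ , eq)) =
    represent k r 1 0 (ℕₚ.≤-trans (s≤s r≤) (ℕₚ.≤-reflexive (ℕₚ.m+[n∸m]≡n (1≤υ (1 ℕ.+ 2 ℕ.* k))))) (s≤s z≤n) refl
      (bounded-intro {excess-at (k , r)} {excess-at (next (k , r))} (ℕₚ.m≤n+m 1 _) z≤n (s≤s z≤n))
      (trans eq (sym (trans (plus-zero _ (node (next (k , r)))) (1-· _))))
  listed⇒represented {x} (k , inj₂ (inj₁ (e , 2≤e , e≤ , eq))) =
    represent k 0 e 0 (1≤υ (1 ℕ.+ 2 ℕ.* k)) (ℕₚ.≤-trans (ℕₚ.<⇒≤ 2≤e) (ℕₚ.m≤m+n e 0)) refl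
      (bounded-intro {m} {n} {e} e≤ z≤n
        (ℕₚ.≤-trans (ℕₚ.≤-reflexive (ℕₚ.+-identityʳ e))
          (ℕₚ.≤-trans e≤ (ℕₚ.≤-trans (ℕₚ.≤-reflexive (ℕₚ.+-comm m 1)) (s≤s (ℕₚ.m≤m+n m n))))))
      (trans eq (sym (plus-zero _ (node (next (k , 0))))))
    where
    m = υ (2 ℕ.* k)
    n = excess-at (next (k , 0))
  listed⇒represented {x} (k , inj₂ (inj₂ (inj₁ (2≤u , f , 1≤f , f≤ , eq)))) =
    represent k r 1 f (ℕₚ.≤-reflexive (sym u≡)) (s≤s z≤n) (next-last {k} {r} u≡)
      (subst (λ j → Bounded (2 ℕ.+ excess-at (k , r)) (2 ℕ.+ υ j) 1 f) (sym (double-suc k))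
        (bounded-intro {excess-at (k , r)} {n} {1} {f} (ℕₚ.m≤n+m 1 _) (ℕₚ.≤-trans f≤ (ℕₚ.m≤m+n n 1))
          (s≤s (ℕₚ.≤-trans f≤ (ℕₚ.m≤n+m n _)))))
      (trans eq (cong₂ (λ y z → y ⊕ f · z) (sym (1-· (node (k , r)))) (sym (node-next-even k))))
    where
    r = υ (1 ℕ.+ 2 ℕ.* k) ℕ.∸ 1
    n = υ (2 ℕ.+ 2 ℕ.* k)
    u≡ : υ (1 ℕ.+ 2 ℕ.* k) ≡ suc r
    u≡ = sym (ℕₚ.m+[n∸m]≡n (1≤υ (1 ℕ.+ 2 ℕ.* k)))
  listed⇒represented {x} (k , inj₂ (inj₂ (inj₂ (inj₁ (2≤u , e , 1≤e , e≤ , eq))))) =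
    represent k 0 e 1 (1≤υ (1 ℕ.+ 2 ℕ.* k)) (ℕₚ.≤-trans 1≤e (ℕₚ.m≤m+n e 1)) (next-inner {k} {0} 2≤u)
      (bounded-intro {m} {0} {e} {1} (ℕₚ.≤-trans e≤ (ℕₚ.m≤m+n m 1)) ℕₚ.≤-refl
        (ℕₚ.≤-trans (ℕₚ.≤-reflexive (ℕₚ.+-comm e 1)) (s≤s (ℕₚ.≤-trans e≤ (ℕₚ.m≤m+n m 0)))))
      (trans eq (cong (e · node (k , 0) ⊕_) (sym (1-· (node (k , 1))))))
    where m = υ (2 ℕ.* k)
  listed⇒represented {x} (k , inj₂ (inj₂ (inj₂ (inj₂ (u≡1 , e , f , 1≤e , e≤ , 1≤f , f≤ , ¬both , eq))))) =
    represent k 0 e f (1≤υ (1 ℕ.+ 2 ℕ.* k)) (ℕₚ.≤-trans 1≤e (ℕₚ.m≤m+n e f)) (next-last {k} {0} u≡1)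
      (subst (λ j → Bounded (2 ℕ.+ m) (2 ℕ.+ υ j) e f) (sym (double-suc k))
        (bounded-intro {m} {n} {e} {f} e≤ f≤ (total (ℕₚ.m≤n⇒m<n∨m≡n e≤) (ℕₚ.m≤n⇒m<n∨m≡n f≤))))
      (trans eq (cong (λ y → e · node (k , 0) ⊕ f · y) (sym (node-next-even k))))
    where
    m = υ (2 ℕ.* k)
    n = υ (2 ℕ.+ 2 ℕ.* k)
    pred-≤ : ∀ {i j} → i ℕ.< j ℕ.+ 1 → i ℕ.≤ j
    pred-≤ {i} {j} lt = ℕₚ.≤-pred (subst (suc i ℕ.≤_) (ℕₚ.+-comm j 1) lt)
    -- The two bounds alone allow e + f = m + n + 2. Excluding the corner makes one of them strict,
    -- which saves the missing 1.
    total : e ℕ.< m ℕ.+ 1 ⊎ e ≡ m ℕ.+ 1 → f ℕ.< n ℕ.+ 1 ⊎ f ≡ n ℕ.+ 1 → e ℕ.+ f ℕ.≤ suc (m ℕ.+ n)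
    total (inj₁ e<) _ = subst (e ℕ.+ f ℕ.≤_) (trans (cong (m ℕ.+_) (ℕₚ.+-comm n 1)) (ℕₚ.+-suc m n))
                          (ℕₚ.+-mono-≤ (pred-≤ e<) f≤)
    total (inj₂ _) (inj₁ f<) = subst (e ℕ.+ f ℕ.≤_) (cong (ℕ._+ n) (ℕₚ.+-comm m 1)) (ℕₚ.+-mono-≤ e≤ (pred-≤ f<))
    total (inj₂ e≡) (inj₂ f≡) = ⊥-elim (¬both (e≡ , f≡))

  UD⇔listed : ∀ x → UniquelyDecomposable D x ⇔ (ListedBy υ α x ⊎ (∃[ y ] (ListedBy υ α y × x ≡ conj D y)))
  UD⇔listed x = mk⇔ (λ ud → to (Equivalence.to (UD⇔represented x) ud))
                    (λ l → Equivalence.from (UD⇔represented x) (from l))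
    where
    to : Represented x ⊎ (∃[ y ] (Represented y × x ≡ conj D y)) → ListedBy υ α x ⊎ (∃[ y ] (ListedBy υ α y × x ≡ conj D y))
    to (inj₁ r)            = inj₁ (represented⇒listed r)
    to (inj₂ (y , r , eq)) = inj₂ (y , represented⇒listed r , eq)
    from : ListedBy υ α x ⊎ (∃[ y ] (ListedBy υ α y × x ≡ conj D y)) → Represented x ⊎ (∃[ y ] (Represented y × x ≡ conj D y))
    from (inj₁ l)            = inj₁ (listed⇒represented l)
    from (inj₂ (y , l , eq)) = inj₂ (y , listed⇒represented l , eq)

theorem4p1 : (D : ℕ) → 2 ≤ D → SquareFree D → (x : OK) →
    UniquelyDecomposable D x ⇔ (Listed D x ⊎ (∃[ y ] (Listed D y × x ≡ conj D y)))
theorem4p1 D 2≤D D-squareFree = UD⇔listed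
  where
  open ContinuedFraction D 2≤D D-squareFree using (1≤u)
  open Signs D 2≤D D-squareFree using (conj-α₁; even-totPos; odd-norm)
  open Vertices D (u D) (αs D) 1≤u (αs-rec D) (αs-zero D) (b-αs-one D) conj-α₁ even-totPos odd-norm
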